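{- (i) For all integers $n\geq r\geq1$, $J_n^{(r)}(q)$ is a monic polynomial in $q$ all of whose coefficients are nonnegative integers, with constant term $(n-r)!$ and degree $\binom{n-1}{2}-\binom{r-1}{2}$; moreover $J_r^{(r)}=1$ for all $r\geq1$. (ii) For all integers $n,r$ with $n-1\geq r\geq1$, $$J_n^{(r)}(q)=\sum_{j=1}^{n-r}[r]_q^{\,j}\,q^{\binom{j}{2}}\binom{n-r}{j}J_{n-r}^{(j)}(q).$$
   Context: Let $\Lambda$ be the ring of symmetric functions in infinitely many variables with coefficients in $\mathbb{Q}(q)$; $e_n$ are the elementary symmetric functions and $m_\lambda$ the monomial symmetric functions. For $n\geq r\geq1$, $p_n^{(r)}=\sum m_\lambda$ over all partitions $\lambda$ of $n$ with exactly $r$ parts. Let $\varphi:\Lambda\to\mathbb{Q}(q)$ be the unique $\mathbb{Q}(q)$-algebra homomorphism with $\varphi(e_n)=q^{\binom n2}/n!$ for $n\geq1$ (specialization of $\sum e_nt^n$ to $E_{xp}(t)=\sum_{n\geq0}q^{\binom n2}t^n/n!$). For $n\geq r\geq1$ define $J_n^{(r)}(q)\in\mathbb{Q}(q)$ by $\varphi(p_n^{(r)})=(1-q)^{n-r}\frac{q^{\binom r2}}{r!\,(n-r)!}J_n^{(r)}(q)$. For $k\geq1$, $[k]_q=1+q+\dots+q^{k-1}$. -}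

module Defs where

open import Data.Nat as ℕ using (ℕ; zero; suc; _∸_; _≤_; _<_; _!)
open import Data.Nat.Properties using (_!≢0)
open import Data.Nat.Combinatorics using (_C_)
open import Data.Integer as ℤ using (ℤ)
open import Data.Rational as ℚ using (ℚ)
open import Data.List using (List; []; _∷_; map; concatMap; _++_; foldr; replicate)
open import Data.Vec as Vec using (Vec; []; _∷_)
open import Data.Vec.Properties using (≡-dec)
open import Data.Bool using (Bool; true; false; if_then_else_)
open import Data.Product using (_×_; _,_)
open import Relation.Nullary using (does)
open import Relation.Binary.PropositionalEquality using (_≡_)

-- Univariate polynomials over a (raw) semiring, as coefficient lists
-- (constant term first).  Equality is coefficientwise.

module UPoly {A : Set} (0# 1# : A) (_⊕_ _⊗_ : A → A → A) where

  coeff : List A → ℕ → A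
  coeff []       _       = 0#
  coeff (a ∷ p)  zero    = a
  coeff (a ∷ p)  (suc k) = coeff p k

  add : List A → List A → List A
  add []      q       = q
  add p       []      = p
  add (a ∷ p) (b ∷ q) = (a ⊕ b) ∷ add p q

  scale : A → List A → List A
  scale c = map (c ⊗_)

  mul : List A → List A → List A
  mul []      q = []
  mul (a ∷ p) q = add (scale a q) (0# ∷ mul p q)

  mono : A → ℕ → List A
  mono a d = replicate d 0# ++ (a ∷ [])

  one : List A
  one = 1# ∷ []

  pow : List A → ℕ → List A
  pow p zero    = one
  pow p (suc k) = mul p (pow p k)

  _≈_ : List A → List A → Set
  p ≈ q = ∀ k → coeff p k ≡ coeff q k

  MonicOfDegree : List A → ℕ → Set
  MonicOfDegree p d = coeff p d ≡ 1# × (∀ k → d < k → coeff p k ≡ 0#)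

module ℕP = UPoly {ℕ} 0 1 ℕ._+_ ℕ._*_
module ℚP = UPoly {ℚ} ℚ.0ℚ ℚ.1ℚ ℚ._+_ ℚ._*_

qint : ℕ → List ℕ
qint zero    = []
qint (suc k) = 1 ∷ qint k

oneMinusQ : List ℚ
oneMinusQ = ℚ.1ℚ ∷ ℚ.- ℚ.1ℚ ∷ []

-- Multivariate polynomials over ℤ in N variables x₁..x_N, as lists of
-- (coefficient, exponent vector); coefficient extraction sums all terms
-- with the given exponent vector.

MPoly : ℕ → Set
MPoly N = List (ℤ × Vec ℕ N)

mcoeff : ∀ {N} → MPoly N → Vec ℕ N → ℤ
mcoeff []             α = ℤ.0ℤ
mcoeff ((c , β) ∷ p)  α =
  if does (≡-dec ℕ._≟_ β α) then c ℤ.+ mcoeff p α else mcoeff p α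

mmul : ∀ {N} → MPoly N → MPoly N → MPoly N
mmul p q = concatMap (λ { (c , α) → map (λ { (d , β) → (c ℤ.* d , Vec.zipWith ℕ._+_ α β) }) q }) p

mone : ∀ {N} → MPoly N
mone {N} = (ℤ.1ℤ , Vec.replicate N 0) ∷ []

-- 0/1 exponent vectors of length N with exactly k ones
-- (i.e. the monomials x_{i1}⋯x_{ik}, i1<⋯<ik)
subsetVecs : (N k : ℕ) → List (Vec ℕ N)
subsetVecs zero    zero    = [] ∷ []
subsetVecs zero    (suc k) = []
subsetVecs (suc N) zero    = map (0 ∷_) (subsetVecs N zero)
subsetVecs (suc N) (suc k) = map (0 ∷_) (subsetVecs N (suc k)) ++ map (1 ∷_) (subsetVecs N k)

elem : (N k : ℕ) → MPoly N
elem N k = map (λ α → (ℤ.1ℤ , α)) (subsetVecs N k)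

elemProd : (N : ℕ) → List ℕ → MPoly N
elemProd N = foldr (λ k p → mmul (elem N k) p) mone

-- A polynomial expression in the e's: a ℤ-linear combination of
-- products e_μ.  Evaluated in N variables:
EExpr : Set
EExpr = List (ℤ × List ℕ)

evalE : (N : ℕ) → EExpr → MPoly N
evalE N = concatMap (λ { (c , μ) → map (λ { (d , α) → (c ℤ.* d , α) }) (elemProd N μ) })

-- Coefficient of x^α in p_n^{(r)} = Σ_{λ ⊢ n, ℓ(λ) = r} m_λ :
-- it is 1 iff |α| = n and α has exactly r nonzero entries, else 0.
vsum : ∀ {N} → Vec ℕ N → ℕ
vsum = Vec.foldr _ ℕ._+_ 0

nonzeros : ∀ {N} → Vec ℕ N → ℕ
nonzeros []           = 0
nonzeros (zero  ∷ α)  = nonzeros α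
nonzeros (suc _ ∷ α)  = suc (nonzeros α)

pnrCoeff : (n r : ℕ) → ∀ {N} → Vec ℕ N → ℤ
pnrCoeff n r α =
  if does (vsum α ℕ.≟ n) then (if does (nonzeros α ℕ.≟ r) then ℤ.1ℤ else ℤ.0ℤ) else ℤ.0ℤ

-- "the expression E represents p_n^{(r)} in Λ": equality in every
-- finite number N of variables (Λ is the inverse limit of the Λ_N).
Represents : EExpr → ℕ → ℕ → Set
Represents E n r = ∀ N (α : Vec ℕ N) → mcoeff (evalE N E) α ≡ pnrCoeff n r α

-- The specialization φ : e_k ↦ q^{binom k 2}/k!, applied to an
-- expression in the e's; the result lies in ℚ[q] ⊂ ℚ(q).

invFact : ℕ → ℚ
invFact k = (ℤ.+ 1) ℚ./ (k !) where instance _ = k !≢0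

φe : ℕ → List ℚ
φe k = ℚP.mono (invFact k) (k C 2)

φμ : List ℕ → List ℚ
φμ = foldr (λ k p → ℚP.mul (φe k) p) ℚP.one

φ : EExpr → List ℚ
φ = foldr (λ { (c , μ) p → ℚP.add (ℚP.scale (c ℚ./ 1) (φμ μ)) p }) []

toℚ : List ℕ → List ℚ
toℚ = map (λ a → (ℤ.+ a) ℚ./ 1)

sumℕP : ℕ → (ℕ → List ℕ) → List ℕ
sumℕP zero    f = []
sumℕP (suc m) f = ℕP.add (sumℕP m f) (f (suc m))

-- Write a_n = q^C(n,2)/n!, E(t) = Σ a_n t^n and H(t) = 1/E(-t). Since
--   Σ p_n^(r) u^r t^n = Π (1 + (u-1) x_i t)/(1 - x_i t),
-- the specialisation P_n^(r) of p_n^(r) is the coefficient of u^r t^n in E((u-1)t) H(t).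
-- The functional equation E^(r)(t) = q^C(r,2) E(q^r t) turns this into
--   r! P_(m+r)^(r) = q^C(r,2) G_m(r),   G_m(r) = [t^m] E(-q^r t) H(t),
-- while setting u = 1 - q^r gives G_m(r) = Σ_j (1-q^r)^j P_m^(j). As m! G_m(r) =
-- (1-q)^m J_(m+r)^(r), the two together are the recurrence (ii); (i) is read off it by induction.
--
-- That φ is well defined is the algebraic independence of the e_k: the lexicographically
-- leading exponent of e_μ is the conjugate partition of μ.

module Submission where

open import Defs
open import Level using (0ℓ)
open import Algebra using (CommutativeRing; CommutativeSemiring; IsCommutativeSemiring)
open import Data.Bool using (true; false; if_then_else_; _∧_)
open import Data.Nat as ℕ using (ℕ; zero; suc; _∸_; _≤_; _<_; z≤n; s≤s; _!)
import Data.Nat.Properties as ℕₚ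
import Data.Nat.DivMod as DivMod
open import Data.Nat.Combinatorics using (_C_; nCk+nC[k+1]≡[n+1]C[k+1]; k>n⇒nCk≡0; nCk≡n!/k![n-k]!; nC1≡n; nCn≡1; k![n∸k]!∣n!)
open import Data.Integer as ℤ using (ℤ)
import Data.Integer.Properties as ℤₚ
open import Data.Rational as ℚ using (ℚ; _/_)
import Data.Rational.Properties as ℚₚ
import Data.Rational.Unnormalised as ℚᵘ
import Data.Rational.Unnormalised.Properties as ℚᵘₚ
open import Data.List using (List; []; _∷_; _++_; map; length; filter; replicate)
import Data.List.Properties as Listₚ
open import Data.List.Extrema.Nat using (max; xs≤max)
open import Data.List.Membership.Propositional using (_∈_)
import Data.List.Membership.Propositional.Properties as ∈ₚ
open import Data.List.Relation.Unary.All as All using (All; []; _∷_)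
import Data.List.Relation.Unary.All.Properties as Allₚ
open import Data.List.Relation.Unary.Any as Any using (here; there)
open import Data.List.Relation.Binary.Permutation.Propositional as Perm using (_↭_; ↭-sym; ↭-trans)
import Data.List.Relation.Binary.Permutation.Propositional.Properties as Permₚ
open import Data.Vec as Vec using (Vec; []; _∷_)
import Data.Vec.Properties as Vecₚ
open import Data.Vec.Properties using (≡-dec)
open import Data.Vec.Relation.Binary.Lex.Strict as Lex using (Lex-<; this; next; base)
open import Data.Vec.Relation.Binary.Pointwise.Inductive using (Pointwise-≡⇒≡)
open import Data.Product using (Σ; ∃; _×_; _,_; proj₁; proj₂)
open import Data.Sum using (_⊎_; inj₁; inj₂)
open import Function using (_∘_; id)
open import Relation.Nullary using (does; yes; no; contradiction; ¬_; ¬?)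
open import Relation.Unary using (Decidable)
open import Relation.Binary using (IsEquivalence; tri<; tri≈; tri>)
open import Relation.Binary.PropositionalEquality as ≡ using (_≡_; _≗_; cong; cong₂)
import Relation.Binary.Reasoning.Setoid as SetoidReasoning
import Algebra.Properties.CommutativeSemigroup as CommutativeSemigroupProperties
import Algebra.Properties.Group as GroupProperties
import Algebra.Properties.Ring as RingProperties
import Algebra.Solver.Ring.NaturalCoefficients.Default as NaturalCoefficients

-- The recurrence is run backwards: `J` is defined by (ii), so (ii) holds by construction and the
-- burden falls on the specialisation formula, proved as m! G_m(r) = (1-q)^m J. The induction on m
-- has to cover all r at once, because expanding G_m(r) produces G_(m-j)(j). The sum in (ii) can
-- start at j = 1 since P_m^(0) = 0 for m > 0, which is how H being the inverse of E(-t) enters. No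
-- division takes place: values of φ lie in ℚ[q] and are handled as coefficient sequences, that is
-- in ℚ[[q]], with the denominators r! (n-r)! cleared and the power of 1-q kept as a factor on the
-- side of J. An element of Λ is given by an integer combination of words, with repetitions, in any
-- order and with factors e_0, and the formula is claimed for every combination that represents
-- p_n^(r). So one explicit expression has to be complemented by uniqueness. The same independence
-- argument, applied to the relation Σ (-1)^m e_m h_(n-m) = 0, yields P_n^(0) = 0.

-- Finite sums, signs and binomial identities in a commutative ring.

module Sums (R : CommutativeRing 0ℓ 0ℓ) where
  open CommutativeRing R hiding (zero)
  open SetoidReasoning setoid
  open RingProperties ring

  open NaturalCoefficients commutativeSemiring using (solve; _:+_; _:*_; _:=_; con)

  sum : ℕ → (ℕ → Carrier) → Carrier
  sum zero    f = 0#
  sum (suc n) f = f 0 + sum n (f ∘ suc)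

  interchange : ∀ a b c d → (a + b) + (c + d) ≈ (a + c) + (b + d)
  interchange = solve 4 (λ a b c d → (a :+ b) :+ (c :+ d) := (a :+ c) :+ (b :+ d)) refl

  sum-cong : ∀ n {f g} → (∀ i → i < n → f i ≈ g i) → sum n f ≈ sum n g
  sum-cong zero    f≈g = refl
  sum-cong (suc n) f≈g =
    +-cong (f≈g 0 (s≤s z≤n)) (sum-cong n (λ i i<n → f≈g (suc i) (s≤s i<n)))

  sum-zero : ∀ n {f} → (∀ i → i < n → f i ≈ 0#) → sum n f ≈ 0#
  sum-zero zero    f≈0 = refl
  sum-zero (suc n) f≈0 = trans
    (+-cong (f≈0 0 (s≤s z≤n)) (sum-zero n (λ i i<n → f≈0 (suc i) (s≤s i<n))))
    (+-identityˡ 0#)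

  sum-+ : ∀ n f g → sum n (λ i → f i + g i) ≈ sum n f + sum n g
  sum-+ zero    f g = sym (+-identityˡ 0#)
  sum-+ (suc n) f g = trans (+-congˡ (sum-+ n (f ∘ suc) (g ∘ suc))) (interchange _ _ _ _)

  sum-distribˡ : ∀ n c f → c * sum n f ≈ sum n (λ i → c * f i)
  sum-distribˡ zero    c f = zeroʳ c
  sum-distribˡ (suc n) c f = trans (distribˡ c _ _) (+-congˡ (sum-distribˡ n c (f ∘ suc)))

  sum-swap : ∀ m n (f : ℕ → ℕ → Carrier) →
    sum m (λ i → sum n (f i)) ≈ sum n (λ j → sum m (λ i → f i j))
  sum-swap zero    n f = sym (sum-zero n (λ _ _ → refl))
  sum-swap (suc m) n f = trans (+-congˡ (sum-swap m n (f ∘ suc)))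
    (sym (sum-+ n (f 0) (λ j → sum m (λ i → f (suc i) j))))

  sum-split : ∀ m n f → sum (m ℕ.+ n) f ≈ sum m f + sum n (λ i → f (m ℕ.+ i))
  sum-split zero    n f = sym (+-identityˡ _)
  sum-split (suc m) n f = trans (+-congˡ (sum-split m n (f ∘ suc))) (sym (+-assoc _ _ _))

  sum-last : ∀ n f → sum (suc n) f ≈ sum n f + f n
  sum-last zero    f = +-comm _ _
  sum-last (suc n) f = trans (+-congˡ (sum-last n (f ∘ suc))) (sym (+-assoc _ _ _))

  pow : Carrier → ℕ → Carrier
  pow x zero    = 1#
  pow x (suc n) = x * pow x n

  pow-cong : ∀ n {x y} → x ≈ y → pow x n ≈ pow y n
  pow-cong zero    x≈y = refl
  pow-cong (suc n) x≈y = *-cong x≈y (pow-cong n x≈y)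

  pow-+ : ∀ x m n → pow x (m ℕ.+ n) ≈ pow x m * pow x n
  pow-+ x zero    n = sym (*-identityˡ _)
  pow-+ x (suc m) n = trans (*-congˡ (pow-+ x m n)) (sym (*-assoc x _ _))

  pow-* : ∀ x y n → pow (x * y) n ≈ pow x n * pow y n
  pow-* x y zero    = sym (*-identityˡ 1#)
  pow-* x y (suc n) = trans (*-congˡ (pow-* x y n)) (lemma x y _ _)
    where
    lemma : ∀ x y a b → x * y * (a * b) ≈ x * a * (y * b)
    lemma = solve 4 (λ x y a b → x :* y :* (a :* b) := x :* a :* (y :* b)) refl

  pow-pow : ∀ x m n → pow (pow x m) n ≈ pow x (m ℕ.* n)
  pow-pow x m zero    = reflexive (cong (pow x) (≡.sym (ℕₚ.*-zeroʳ m)))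
  pow-pow x m (suc n) = begin
    pow x m * pow (pow x m) n   ≈⟨ *-congˡ (pow-pow x m n) ⟩
    pow x m * pow x (m ℕ.* n)   ≈⟨ pow-+ x m (m ℕ.* n) ⟨
    pow x (m ℕ.+ m ℕ.* n)       ≡⟨ cong (pow x) (ℕₚ.*-suc m n) ⟨
    pow x (m ℕ.* suc n)         ∎

  ι : ℕ → Carrier
  ι zero    = 0#
  ι (suc n) = 1# + ι n

  ι-+ : ∀ m n → ι (m ℕ.+ n) ≈ ι m + ι n
  ι-+ zero    n = sym (+-identityˡ _)
  ι-+ (suc m) n = trans (+-congˡ (ι-+ m n)) (sym (+-assoc _ _ _))

  ι-* : ∀ m n → ι (m ℕ.* n) ≈ ι m * ι n
  ι-* zero    n = sym (zeroˡ _)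
  ι-* (suc m) n = begin
    ι (n ℕ.+ m ℕ.* n)      ≈⟨ ι-+ n (m ℕ.* n) ⟩
    ι n + ι (m ℕ.* n)      ≈⟨ +-congˡ (ι-* m n) ⟩
    ι n + ι m * ι n        ≈⟨ lemma (ι n) (ι m) ⟩
    (1# + ι m) * ι n       ∎
    where
    lemma : ∀ x y → x + y * x ≈ (1# + y) * x
    lemma = solve 2 (λ x y → x :+ y :* x := (con 1 :+ y) :* x) refl

  -- Keeping -1 as an atom leaves the sign manipulations to a semiring solver; what is special about
  -- it enters through `1+s≈0`, `s*s≈1` and `sx+x≈0`.
  s : Carrier
  s = - 1#

  1+s≈0 : 1# + s ≈ 0#
  1+s≈0 = -‿inverseʳ 1#

  s*s≈1 : s * s ≈ 1#
  s*s≈1 = trans (-1*x≈-x s) (-‿involutive 1#)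

  sx+x≈0 : ∀ x → s * x + x ≈ 0#
  sx+x≈0 x = trans (+-congʳ (-1*x≈-x x)) (-‿inverseˡ x)

  sgn : ℕ → Carrier
  sgn = pow s

  sgn-double : ∀ n → sgn n * sgn n ≈ 1#
  sgn-double n = trans (sym (pow-* s s n)) (trans (pow-cong n s*s≈1) (pow-1 n))
    where
    pow-1 : ∀ n → pow 1# n ≈ 1#
    pow-1 zero    = refl
    pow-1 (suc n) = trans (*-identityˡ _) (pow-1 n)

  ιC-suc : ∀ n k → ι (suc n C suc k) ≈ ι (n C k) + ι (n C suc k)
  ιC-suc n k = trans (reflexive (cong ι (≡.sym (nCk+nC[k+1]≡[n+1]C[k+1] n k)))) (ι-+ (n C k) (n C suc k))

  ιC-zero : ∀ n k → n < k → ι (n C k) ≈ 0#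
  ιC-zero n k n<k = reflexive (cong ι (k>n⇒nCk≡0 n<k))

  -- The upper limit may exceed `i` because the further binomial coefficients vanish. The induction
  -- relies on this slack: Pascal's rule leaves sums of lengths n+1 and n+2 for the same `i`.
  binomial : ∀ n i z → i ≤ n → sum (suc n) (λ j → ι (i C j) * pow z j) ≈ pow (1# + z) i
  binomial n zero z _ = begin
    ι 1 * 1# + sum n (λ j → ι (0 C suc j) * pow z (suc j))
      ≈⟨ +-cong (*-identityʳ _) (sum-zero n (λ j _ → trans (*-congʳ (ιC-zero 0 (suc j) (s≤s z≤n))) (zeroˡ _))) ⟩
    ι 1 + 0#  ≈⟨ trans (+-identityʳ _) (+-identityʳ _) ⟩
    1#        ∎
  binomial (suc n) (suc i) z (s≤s i≤n) = begin
    ι 1 * 1# + sum (suc n) (λ j → ι (suc i C suc j) * pow z (suc j))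
      ≈⟨ +-congˡ (sum-cong (suc n) (λ j _ → trans (*-congʳ (ιC-suc i j)) (lemma (ι (i C j)) (ι (i C suc j)) z (pow z j)))) ⟩
    ι 1 * 1# + sum (suc n) (λ j → z * (ι (i C j) * pow z j) + ι (i C suc j) * pow z (suc j))
      ≈⟨ +-congˡ (sum-+ (suc n) (λ j → z * (ι (i C j) * pow z j)) (λ j → ι (i C suc j) * pow z (suc j))) ⟩
    ι 1 * 1# + (sum (suc n) (λ j → z * (ι (i C j) * pow z j)) + sum (suc n) (λ j → ι (i C suc j) * pow z (suc j)))
      ≈⟨ +-congˡ (+-congʳ (sym (sum-distribˡ (suc n) z (λ j → ι (i C j) * pow z j)))) ⟩
    ι 1 * 1# + (z * sum (suc n) (λ j → ι (i C j) * pow z j) + sum (suc n) (λ j → ι (i C suc j) * pow z (suc j)))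
      ≈⟨ lemma₂ _ _ _ ⟩
    z * sum (suc n) (λ j → ι (i C j) * pow z j) + sum (suc (suc n)) (λ j → ι (i C j) * pow z j)
      ≈⟨ +-cong (*-congˡ (binomial n i z i≤n)) (binomial (suc n) i z (ℕₚ.m≤n⇒m≤1+n i≤n)) ⟩
    z * pow (1# + z) i + pow (1# + z) i
      ≈⟨ lemma₃ _ _ ⟩
    (1# + z) * pow (1# + z) i ∎
    where
    lemma : ∀ a b z p → (a + b) * (z * p) ≈ z * (a * p) + b * (z * p)
    lemma = solve 4 (λ a b z p → (a :+ b) :* (z :* p) := z :* (a :* p) :+ b :* (z :* p)) refl
    lemma₂ : ∀ a b c → a + (b + c) ≈ b + (a + c)
    lemma₂ = solve 3 (λ a b c → a :+ (b :+ c) := b :+ (a :+ c)) refl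
    lemma₃ : ∀ z p → z * p + p ≈ (1# + z) * p
    lemma₃ = solve 2 (λ z p → z :* p :+ p := (con 1 :+ z) :* p) refl

  δ : ℕ → ℕ → Carrier
  δ zero    zero    = 1#
  δ zero    (suc n) = 0#
  δ (suc m) zero    = 0#
  δ (suc m) (suc n) = δ m n

  -- This is the coefficient of u^r in u^p = (1 + (u-1))^p, with (-1)^(m-r) written as
  -- `sgn (m + r)`. The induction applies Pascal's rule to both binomial coefficients.
  binomial-inversion : ∀ n p r → p ≤ n →
    sum (suc n) (λ m → sgn (m ℕ.+ r) * ι (m C r) * ι (p C m)) ≈ δ p r
  binomial-inversion n zero r _ = trans
    (+-cong (head r) (sum-zero n (λ j _ → trans (*-congˡ (ιC-zero 0 (suc j) (s≤s z≤n))) (zeroʳ _))))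
    (+-identityʳ _)
    where
    head : ∀ r → sgn r * ι (0 C r) * ι 1 ≈ δ 0 r
    head zero    = trans (*-cong (*-identityˡ _) refl) (lemma 1#)
      where
      lemma : ∀ x → (1# + 0#) * (1# + 0#) ≈ 1#
      lemma = solve 1 (λ x → (con 1 :+ con 0) :* (con 1 :+ con 0) := con 1) refl
    head (suc r) = trans (*-congʳ (trans (*-congˡ (ιC-zero 0 (suc r) (s≤s z≤n))) (zeroʳ _))) (zeroˡ _)
  binomial-inversion (suc n) (suc p) zero (s≤s p≤n) = begin
    sum (suc (suc n)) (λ m → sgn (m ℕ.+ 0) * ι 1 * ι (suc p C m))
      ≈⟨ sum-cong (suc (suc n)) (λ m _ → trans
           (*-congʳ (*-congʳ (reflexive (cong sgn (ℕₚ.+-identityʳ m)))))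
           (solve 2 (λ x y → x :* (con 1 :+ con 0) :* y := y :* x) refl (sgn m) (ι (suc p C m)))) ⟩
    sum (suc (suc n)) (λ m → ι (suc p C m) * sgn m)
      ≈⟨ binomial (suc n) (suc p) s (s≤s p≤n) ⟩
    (1# + s) * pow (1# + s) p
      ≈⟨ trans (*-congʳ 1+s≈0) (zeroˡ _) ⟩
    0# ∎
  binomial-inversion (suc n) (suc p) (suc r) (s≤s p≤n) = begin
    F 0 * ι 1 + sum (suc n) (λ m → F (suc m) * ι (suc p C suc m))
      ≈⟨ +-cong (trans (*-congʳ F0≈0) (zeroˡ _)) (sum-cong (suc n) (λ m _ → step m)) ⟩
    0# + sum (suc n) (λ m → E r m + (s * E (suc r) m + F (suc m) * ι (p C suc m)))
      ≈⟨ trans (+-identityˡ _) (trans (sum-+ (suc n) (E r) (λ m → s * E (suc r) m + G m)) (+-congˡ (sum-+ (suc n) (λ m → s * E (suc r) m) G))) ⟩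
    sum (suc n) (E r) + (sum (suc n) (λ m → s * E (suc r) m) + sum (suc n) (λ m → F (suc m) * ι (p C suc m)))
      ≈⟨ +-cong (binomial-inversion n p r p≤n) (+-cong
           (trans (sym (sum-distribˡ (suc n) s (E (suc r)))) (*-congˡ (binomial-inversion n p (suc r) p≤n)))
           tail) ⟩
    -- The last two terms come from C(m,r+1) C(p,m) and C(m+1,r+1) C(p,m+1); the index shift by one
    -- gives them opposite signs.
    δ p r + (s * δ p (suc r) + δ p (suc r))
      ≈⟨ trans (+-congˡ (sx+x≈0 _)) (+-identityʳ _) ⟩
    δ p r ∎
    where
    E : ℕ → ℕ → Carrier
    E r m = sgn (m ℕ.+ r) * ι (m C r) * ι (p C m)
    F : ℕ → Carrier
    F m = sgn (m ℕ.+ suc r) * ι (m C suc r)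
    G : ℕ → Carrier
    G m = F (suc m) * ι (p C suc m)
    F0≈0 : F 0 ≈ 0#
    F0≈0 = trans (*-congˡ (ιC-zero 0 (suc r) (s≤s z≤n))) (zeroʳ _)
    tail : sum (suc n) (λ m → F (suc m) * ι (p C suc m)) ≈ δ p (suc r)
    tail = trans (sym (trans (+-congʳ (trans (*-congʳ F0≈0) (zeroˡ _))) (+-identityˡ _)))
      (binomial-inversion (suc n) p (suc r) (ℕₚ.m≤n⇒m≤1+n p≤n))
    sign : ∀ m → sgn (suc m ℕ.+ suc r) ≈ sgn (m ℕ.+ r)
    sign m = trans (*-congˡ (reflexive (cong sgn (ℕₚ.+-suc m r))))
      (trans (sym (*-assoc s s _)) (trans (*-congʳ s*s≈1) (*-identityˡ _)))
    step : ∀ m → F (suc m) * ι (suc p C suc m) ≈ E r m + (s * E (suc r) m + F (suc m) * ι (p C suc m))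
    step m = begin
      F (suc m) * ι (suc p C suc m)
        ≈⟨ trans (*-congˡ (ιC-suc p m)) (distribˡ _ _ _) ⟩
      F (suc m) * ι (p C m) + F (suc m) * ι (p C suc m)
        ≈⟨ +-congʳ (*-congʳ (trans (*-congˡ (ιC-suc m r)) (distribˡ _ _ _))) ⟩
      (sgn (suc m ℕ.+ suc r) * ι (m C r) + s * sgn (m ℕ.+ suc r) * ι (m C suc r)) * ι (p C m) + F (suc m) * ι (p C suc m)
        ≈⟨ +-congʳ (*-congʳ (+-congʳ (*-congʳ (sign m)))) ⟩
      (sgn (m ℕ.+ r) * ι (m C r) + s * sgn (m ℕ.+ suc r) * ι (m C suc r)) * ι (p C m) + F (suc m) * ι (p C suc m)
        ≈⟨ solve 7 (λ x c s y d e f → (x :* c :+ s :* y :* d) :* e :+ f := x :* c :* e :+ (s :* (y :* d :* e) :+ f)) refl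
             (sgn (m ℕ.+ r)) (ι (m C r)) s (sgn (m ℕ.+ suc r)) (ι (m C suc r)) (ι (p C m)) (G m) ⟩
      E r m + (s * E (suc r) m + F (suc m) * ι (p C suc m)) ∎

-- Coefficient sequences under convolution, and the ring of power series.

module Convolution {A : Set} {_+_ _*_ : A → A → A} {0# 1# : A}
  (isCommutativeSemiring : IsCommutativeSemiring _≡_ _+_ _*_ 0# 1#) where

  open IsCommutativeSemiring isCommutativeSemiring
    using (+-identityˡ; +-identityʳ; *-identityˡ; *-comm; +-comm; +-assoc; zeroˡ; zeroʳ; distribˡ; distribʳ; *-assoc)

  commutativeSemiring : CommutativeSemiring 0ℓ 0ℓ
  commutativeSemiring = record { isCommutativeSemiring = isCommutativeSemiring }
  open NaturalCoefficients commutativeSemiring using (solve; _:+_; _:*_; _:=_)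
  open UPoly 0# 1# _+_ _*_
  open ≡ using (refl; sym; trans)
  open ≡.≡-Reasoning

  -- Recursion on the first factor follows `mul`, which makes `coeff-mul` a direct induction;
  -- commutativity then rests on the expansion from the other end, `conv-last`.
  conv : (ℕ → A) → (ℕ → A) → ℕ → A
  conv f g zero    = f 0 * g 0
  conv f g (suc k) = (f 0 * g (suc k)) + conv (f ∘ suc) g k

  conv-cong : ∀ {f f′ g g′} → f ≗ f′ → g ≗ g′ → conv f g ≗ conv f′ g′
  conv-cong f≗f′ g≗g′ zero    = cong₂ _*_ (f≗f′ 0) (g≗g′ 0)
  conv-cong f≗f′ g≗g′ (suc k) = cong₂ _+_ (cong₂ _*_ (f≗f′ 0) (g≗g′ (suc k)))
    (conv-cong (f≗f′ ∘ suc) g≗g′ k)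

  conv-last : ∀ f g k → conv f g (suc k) ≡ conv f (g ∘ suc) k + (f (suc k) * g 0)
  conv-last f g zero    = refl
  conv-last f g (suc k) = trans (cong (_ +_) (conv-last (f ∘ suc) g k)) (sym (+-assoc _ _ _))

  conv-comm : ∀ f g → conv f g ≗ conv g f
  conv-comm f g zero    = *-comm _ _
  conv-comm f g (suc k) = begin
    (f 0 * g (suc k)) + conv (f ∘ suc) g k  ≡⟨ +-comm _ _ ⟩
    conv (f ∘ suc) g k + (f 0 * g (suc k))  ≡⟨ cong₂ _+_ (conv-comm (f ∘ suc) g k) (*-comm _ _) ⟩
    conv g (f ∘ suc) k + (g (suc k) * f 0)  ≡⟨ conv-last g f k ⟨
    conv g f (suc k)                        ∎

  conv-zeroˡ : ∀ {f} g → (∀ k → f k ≡ 0#) → ∀ k → conv f g k ≡ 0#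
  conv-zeroˡ g f≡0 zero    = trans (cong (_* _) (f≡0 0)) (zeroˡ _)
  conv-zeroˡ g f≡0 (suc k) = trans
    (cong₂ _+_ (trans (cong (_* _) (f≡0 0)) (zeroˡ _)) (conv-zeroˡ g (f≡0 ∘ suc) k))
    (+-identityˡ 0#)

  conv-distribʳ : ∀ h f g → conv (λ k → f k + g k) h ≗ λ k → conv f h k + conv g h k
  conv-distribʳ h f g zero    = distribʳ _ _ _
  conv-distribʳ h f g (suc k) = trans (cong (_ +_) (conv-distribʳ h (f ∘ suc) (g ∘ suc) k))
    (solve 5 (λ a b c d e → (a :+ b) :* c :+ (d :+ e) := (a :* c :+ d) :+ (b :* c :+ e)) refl
      (f 0) (g 0) (h (suc k)) (conv (f ∘ suc) h k) (conv (g ∘ suc) h k))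

  conv-scaleˡ : ∀ c f g → conv (λ k → c * f k) g ≗ λ k → c * conv f g k
  conv-scaleˡ c f g zero    = *-assoc _ _ _
  conv-scaleˡ c f g (suc k) = trans (cong₂ _+_ (*-assoc _ _ _) (conv-scaleˡ c (f ∘ suc) g k))
    (sym (distribˡ _ _ _))

  conv-assoc : ∀ f g h → conv (conv f g) h ≗ conv f (conv g h)
  conv-assoc f g h zero    = *-assoc _ _ _
  conv-assoc f g h (suc k) = begin
    ((f 0 * g 0) * h (suc k)) + conv (λ i → (f 0 * g (suc i)) + conv (f ∘ suc) g i) h k
      ≡⟨ cong (_ +_) (conv-distribʳ h (λ i → f 0 * g (suc i)) (conv (f ∘ suc) g) k) ⟩
    ((f 0 * g 0) * h (suc k)) + (conv (λ i → f 0 * g (suc i)) h k + conv (conv (f ∘ suc) g) h k)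
      ≡⟨ cong (_ +_) (cong₂ _+_ (conv-scaleˡ (f 0) (g ∘ suc) h k) (conv-assoc (f ∘ suc) g h k)) ⟩
    ((f 0 * g 0) * h (suc k)) + ((f 0 * conv (g ∘ suc) h k) + conv (f ∘ suc) (conv g h) k)
      ≡⟨ solve 5 (λ a b c d e → a :* b :* c :+ (a :* d :+ e) := a :* (b :* c :+ d) :+ e) refl
           (f 0) (g 0) (h (suc k)) (conv (g ∘ suc) h k) _ ⟩
    (f 0 * conv g h (suc k)) + conv (f ∘ suc) (conv g h) k ∎

  const : A → ℕ → A
  const c zero    = c
  const c (suc k) = 0#

  conv-constˡ : ∀ c g → conv (const c) g ≗ λ k → c * g k
  conv-constˡ c g zero    = refl
  conv-constˡ c g (suc k) = trans (cong (_ +_) (conv-zeroˡ g (λ _ → refl) k)) (+-identityʳ _)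

  shift : (ℕ → A) → ℕ → A
  shift f zero    = 0#
  shift f (suc k) = f k

  conv-shiftˡ : ∀ f g → conv (shift f) g ≗ shift (conv f g)
  conv-shiftˡ f g zero    = zeroˡ _
  conv-shiftˡ f g (suc k) = trans (cong (_+ conv f g k) (zeroˡ _)) (+-identityˡ _)

  -- Among the products `f i * g j` with i + j = d + e, all but the one at (d, e) have an index
  -- beyond its bound; beyond d + e every product has one.
  conv-top : ∀ {f g} d e → (∀ k → d < k → f k ≡ 0#) → (∀ k → e < k → g k ≡ 0#) →
    conv f g (d ℕ.+ e) ≡ f d * g e × (∀ k → d ℕ.+ e < k → conv f g k ≡ 0#)
  conv-top {f} {g} zero e f≡0 g≡0 = at e , above
    where
    at : ∀ e → conv f g e ≡ f 0 * g e
    at zero    = refl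
    at (suc e) = trans (cong (_ +_) (conv-zeroˡ g (λ k → f≡0 (suc k) (s≤s z≤n)) e)) (+-identityʳ _)
    above : ∀ k → e < k → conv f g k ≡ 0#
    above k e<k = trans (at k) (trans (cong (_ *_) (g≡0 k e<k)) (zeroʳ _))
  conv-top {f} {g} (suc d) e f≡0 g≡0 = at , above
    where
    rec : conv (f ∘ suc) g (d ℕ.+ e) ≡ f (suc d) * g e × (∀ k → d ℕ.+ e < k → conv (f ∘ suc) g k ≡ 0#)
    rec = conv-top d e (λ k d<k → f≡0 (suc k) (s≤s d<k)) g≡0
    head : ∀ k → d ℕ.+ e < suc k → f 0 * g (suc k) ≡ 0#
    head k d+e<k = trans (cong (_ *_) (g≡0 (suc k) (ℕₚ.≤-trans (s≤s (ℕₚ.m≤n+m e d)) d+e<k))) (zeroʳ _)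
    at : conv f g (suc d ℕ.+ e) ≡ f (suc d) * g e
    at = trans (cong₂ _+_ (head (d ℕ.+ e) ℕₚ.≤-refl) (proj₁ rec)) (+-identityˡ _)
    above : ∀ k → suc d ℕ.+ e < k → conv f g k ≡ 0#
    above (suc k) (s≤s d+e<k) = trans (cong₂ _+_ (head k (ℕₚ.m≤n⇒m≤1+n d+e<k)) (proj₂ rec k d+e<k)) (+-identityˡ _)

  coeff-add : ∀ p q k → coeff (add p q) k ≡ coeff p k + coeff q k
  coeff-add []      q       k       = sym (+-identityˡ _)
  coeff-add (a ∷ p) []      k       = sym (+-identityʳ _)
  coeff-add (a ∷ p) (b ∷ q) zero    = refl
  coeff-add (a ∷ p) (b ∷ q) (suc k) = coeff-add p q k

  coeff-scale : ∀ c p k → coeff (scale c p) k ≡ c * coeff p k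
  coeff-scale c []      k       = sym (zeroʳ c)
  coeff-scale c (a ∷ p) zero    = refl
  coeff-scale c (a ∷ p) (suc k) = coeff-scale c p k

  coeff-mul : ∀ p q → coeff (mul p q) ≗ conv (coeff p) (coeff q)
  coeff-mul []      q k = sym (conv-zeroˡ (coeff q) (λ _ → refl) k)
  coeff-mul (a ∷ p) q k = trans (coeff-add (scale a q) (0# ∷ mul p q) k)
    (trans (cong (_+ _) (coeff-scale a q k)) (tail k))
    where
    tail : ∀ k → (a * coeff q k) + coeff (0# ∷ mul p q) k ≡ conv (coeff (a ∷ p)) (coeff q) k
    tail zero    = +-identityʳ _
    tail (suc k) = cong (_ +_) (coeff-mul p q k)

  coeff-one : coeff one ≗ const 1#
  coeff-one zero    = refl
  coeff-one (suc k) = refl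

module ℕConv = Convolution ℕₚ.+-*-isCommutativeSemiring
module ℚConv = Convolution (CommutativeRing.isCommutativeSemiring ℚₚ.+-*-commutativeRing)

-- Equality of polynomials is coefficientwise, so passing to sequences turns it into the equality of
-- ℚ[[q]], where ring reasoning is available.
series : CommutativeRing 0ℓ 0ℓ
series = record
  { Carrier = ℕ → ℚ
  ; _≈_ = _≗_
  ; _+_ = λ f g k → f k ℚ.+ g k
  ; _*_ = conv
  ; -_  = λ f k → ℚ.- f k
  ; 0#  = λ _ → ℚ.0ℚ
  ; 1#  = const ℚ.1ℚ
  ; isCommutativeRing = record
    { isRing = record
      { +-isAbelianGroup = record
        { isGroup = record
          { isMonoid = record
            { isSemigroup = record
              { isMagma = record
                { isEquivalence = record
                  { refl  = λ _ → ≡.refl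
                  ; sym   = λ f≗g k → ≡.sym (f≗g k)
                  ; trans = λ f≗g g≗h k → ≡.trans (f≗g k) (g≗h k)
                  }
                ; ∙-cong = λ f≗f′ g≗g′ k → cong₂ ℚ._+_ (f≗f′ k) (g≗g′ k)
                }
              ; assoc = λ f g h k → ℚₚ.+-assoc (f k) (g k) (h k)
              }
            ; identity = (λ f k → ℚₚ.+-identityˡ (f k)) , (λ f k → ℚₚ.+-identityʳ (f k))
            }
          ; inverse = (λ f k → ℚₚ.+-inverseˡ (f k)) , (λ f k → ℚₚ.+-inverseʳ (f k))
          ; ⁻¹-cong = λ f≗g k → cong ℚ.-_ (f≗g k)
          }
        ; comm = λ f g k → ℚₚ.+-comm (f k) (g k)
        }
      ; *-cong = conv-cong
      ; *-assoc = conv-assoc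
      ; *-identity = identityˡ , λ f k → ≡.trans (conv-comm f (const ℚ.1ℚ) k) (identityˡ f k)
      ; distrib = (λ h f g k → ≡.trans (conv-comm h _ k) (≡.trans (conv-distribʳ h f g k)
                    (cong₂ ℚ._+_ (conv-comm f h k) (conv-comm g h k))))
                , conv-distribʳ
      }
    ; *-comm = conv-comm
    }
  }
  where
  open ℚConv
  identityˡ : ∀ f → conv (const ℚ.1ℚ) f ≗ f
  identityˡ f k = ≡.trans (conv-constˡ ℚ.1ℚ f k) (ℚₚ.*-identityˡ (f k))

-- Binomial coefficients in ℕ.

suc-C2 : ∀ n → suc n C 2 ≡ n ℕ.+ n C 2
suc-C2 n = ≡.trans (≡.sym (nCk+nC[k+1]≡[n+1]C[k+1] n 1)) (cong (ℕ._+ n C 2) (nC1≡n n))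

-- A pair of points from two blocks lies in the first, in the second, or across. In exponents of q,
-- the cross term m n is what turns an index shift by r into the substitution of q^r t for t.
+-C2 : ∀ m n → (m ℕ.+ n) C 2 ≡ m C 2 ℕ.+ (n C 2 ℕ.+ m ℕ.* n)
+-C2 zero    n = ≡.sym (ℕₚ.+-identityʳ (n C 2))
+-C2 (suc m) n = begin
  suc (m ℕ.+ n) C 2                                      ≡⟨ suc-C2 (m ℕ.+ n) ⟩
  m ℕ.+ n ℕ.+ (m ℕ.+ n) C 2                              ≡⟨ cong (m ℕ.+ n ℕ.+_) (+-C2 m n) ⟩
  m ℕ.+ n ℕ.+ (m C 2 ℕ.+ (n C 2 ℕ.+ m ℕ.* n))
    ≡⟨ solve 5 (λ m n a b c → m :+ n :+ (a :+ (b :+ c)) := m :+ a :+ (b :+ (n :+ c))) ≡.refl m n (m C 2) (n C 2) (m ℕ.* n) ⟩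
  m ℕ.+ m C 2 ℕ.+ (n C 2 ℕ.+ (n ℕ.+ m ℕ.* n))            ≡⟨ cong (ℕ._+ (n C 2 ℕ.+ suc m ℕ.* n)) (suc-C2 m) ⟨
  suc m C 2 ℕ.+ (n C 2 ℕ.+ suc m ℕ.* n)                  ∎
  where
  open ≡.≡-Reasoning
  open NaturalCoefficients ℕₚ.+-*-commutativeSemiring using (solve; _:+_; _:=_)

C-factorial : ∀ k l → ((k ℕ.+ l) C k) ℕ.* (k ! ℕ.* l !) ≡ (k ℕ.+ l) !
C-factorial k l = begin
  ((k ℕ.+ l) C k) ℕ.* (k ! ℕ.* l !)
    ≡⟨ cong (λ j → ((k ℕ.+ l) C k) ℕ.* (k ! ℕ.* j !)) (ℕₚ.m+n∸m≡n k l) ⟨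
  ((k ℕ.+ l) C k) ℕ.* (k ! ℕ.* (k ℕ.+ l ∸ k) !)
    ≡⟨ cong (ℕ._* (k ! ℕ.* (k ℕ.+ l ∸ k) !)) (nCk≡n!/k![n-k]! (ℕₚ.m≤m+n k l)) ⟩
  ((k ℕ.+ l) ! ℕ./ (k ! ℕ.* (k ℕ.+ l ∸ k) !)) ℕ.* (k ! ℕ.* (k ℕ.+ l ∸ k) !)
    ≡⟨ DivMod.m/n*n≡m (k![n∸k]!∣n! (ℕₚ.m≤m+n k l)) ⟩
  (k ℕ.+ l) ! ∎
  where
  open ≡.≡-Reasoning
  instance _ = k ℕₚ.!* (k ℕ.+ l ∸ k) !≢0

-- The evaluation of p_n^(r) over an abstract ring.

-- The data of φ that the computation uses: `f n` stands for 1/n!, `h n` for φ(h_n), `[ r ]` for the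
-- q-integer. `J m r` stands for J_(m+r)^(r) and is given by recurrence (ii), with j = i + 1 as
-- summation index.
record Specialisation (R : CommutativeRing 0ℓ 0ℓ) : Set where
  open CommutativeRing R hiding (zero)
  open Sums R public
  field
    q    : Carrier
    f    : ℕ → Carrier
    f!≈1 : ∀ n → ι (n !) * f n ≈ 1#
    h    : ℕ → Carrier

  a : ℕ → Carrier
  a n = f n * pow q (n C 2)

  P : ℕ → ℕ → Carrier
  P n r = sum (suc n) (λ i → sgn (i ℕ.+ r) * ι (i C r) * (a i * h (n ∸ i)))

  field
    h₀≈1 : h 0 ≈ 1#
    -- `P n 0` is the coefficient of t^n in E(-t) H(t), so together with `h₀≈1` this says H(t) =
    -- 1/E(-t).
    P₀≈0 : ∀ n → P (suc n) 0 ≈ 0#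

  p : Carrier
  p = 1# + s * q

  field
    [_]      : ℕ → Carrier
    p*[r]    : ∀ r → p * [ r ] ≈ 1# + s * pow q r
    J        : ℕ → ℕ → Carrier
    J-zero   : ∀ r → J 0 r ≈ 1#
    J-suc    : ∀ m r → J (suc m) r ≈
      sum (suc m) (λ i → pow [ r ] (suc i) * (ι (suc m C suc i) * pow q (suc i C 2) * J (m ∸ i) (suc i)))

module Evaluate {R : CommutativeRing 0ℓ 0ℓ} (φ : Specialisation R) where
  open CommutativeRing R hiding (zero)
  open Specialisation φ
  open SetoidReasoning setoid
  open NaturalCoefficients commutativeSemiring using (solve; _:+_; _:*_; _:=_; con)

  -- The coefficient of t^m in E(-q^r t)/E(-t).
  G : ℕ → ℕ → Carrier
  G m r = sum (suc m) (λ i → sgn i * pow q (r ℕ.* i) * (a i * h (m ∸ i)))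

  -- The r-th derivative sends t^(r+i)/(r+i)! to t^i/i!. As `f` is known only as an inverse of the
  -- factorials, the unit `ι (i !) * f i` is inserted first.
  factorial-C-f : ∀ r i → ι (r !) * (ι ((r ℕ.+ i) C r) * f (r ℕ.+ i)) ≈ f i
  factorial-C-f r i = begin
    R! * (B * F)                        ≈⟨ trans (sym (*-identityʳ _)) (*-congˡ (sym (f!≈1 i))) ⟩
    R! * (B * F) * (ι (i !) * f i)      ≈⟨ solve 5 (λ r b f i g → r :* (b :* f) :* (i :* g) := b :* (r :* i) :* f :* g) refl R! B F (ι (i !)) (f i) ⟩
    B * (R! * ι (i !)) * F * f i        ≈⟨ *-congʳ (*-congʳ (trans (*-congˡ (sym (ι-* (r !) (i !)))) (sym (ι-* ((r ℕ.+ i) C r) (r ! ℕ.* i !))))) ⟩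
    ι (((r ℕ.+ i) C r) ℕ.* (r ! ℕ.* i !)) * F * f i  ≡⟨ cong (λ n → ι n * F * f i) (C-factorial r i) ⟩
    ι ((r ℕ.+ i) !) * F * f i           ≈⟨ trans (*-congʳ (f!≈1 (r ℕ.+ i))) (*-identityˡ _) ⟩
    f i                                 ∎
    where
    R! B F : Carrier
    R! = ι (r !)
    B  = ι ((r ℕ.+ i) C r)
    F  = f (r ℕ.+ i)

  sgn-cancel : ∀ r i → sgn (r ℕ.+ i ℕ.+ r) ≈ sgn i
  sgn-cancel r i = begin
    sgn (r ℕ.+ i ℕ.+ r)       ≈⟨ trans (pow-+ s (r ℕ.+ i) r) (*-congʳ (pow-+ s r i)) ⟩
    sgn r * sgn i * sgn r     ≈⟨ solve 2 (λ x y → x :* y :* x := x :* x :* y) refl (sgn r) (sgn i) ⟩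
    sgn r * sgn r * sgn i     ≈⟨ trans (*-congʳ (sgn-double r)) (*-identityˡ _) ⟩
    sgn i                     ∎

  -- The functional equation of E^(r), read coefficientwise: C(i,r) removes the terms with i < r,
  -- and after the shift by r the factorials collapse by `factorial-C-f` while `+-C2` splits the
  -- power of q.
  factorial-P : ∀ r m → ι (r !) * P (r ℕ.+ m) r ≈ pow q (r C 2) * G m r
  factorial-P r m = begin
    ι (r !) * P (r ℕ.+ m) r
      ≡⟨ cong (λ n → ι (r !) * sum n T) (ℕₚ.+-suc r m) ⟨
    ι (r !) * sum (r ℕ.+ suc m) T
      ≈⟨ *-congˡ (trans (sum-split r (suc m) T) (trans (+-congʳ (sum-zero r below)) (+-identityˡ _))) ⟩
    ι (r !) * sum (suc m) (T ∘ (r ℕ.+_))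
      ≈⟨ sum-distribˡ (suc m) (ι (r !)) (T ∘ (r ℕ.+_)) ⟩
    sum (suc m) (λ i → ι (r !) * T (r ℕ.+ i))
      ≈⟨ sum-cong (suc m) (λ i _ → term i) ⟩
    sum (suc m) (λ i → pow q (r C 2) * (sgn i * pow q (r ℕ.* i) * (a i * h (m ∸ i))))
      ≈⟨ sum-distribˡ (suc m) (pow q (r C 2)) (λ i → sgn i * pow q (r ℕ.* i) * (a i * h (m ∸ i))) ⟨
    pow q (r C 2) * G m r ∎
    where
    T : ℕ → Carrier
    T i = sgn (i ℕ.+ r) * ι (i C r) * (a i * h (r ℕ.+ m ∸ i))
    below : ∀ i → i < r → T i ≈ 0#
    below i i<r = trans (*-congʳ (trans (*-congˡ (ιC-zero i r i<r)) (zeroʳ _))) (zeroˡ _)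
    pow-C2 : ∀ i → pow q ((r ℕ.+ i) C 2) ≈ pow q (r C 2) * (pow q (i C 2) * pow q (r ℕ.* i))
    pow-C2 i = trans (reflexive (cong (pow q) (+-C2 r i)))
      (trans (pow-+ q (r C 2) _) (*-congˡ (pow-+ q (i C 2) (r ℕ.* i))))
    term : ∀ i → ι (r !) * T (r ℕ.+ i) ≈ pow q (r C 2) * (sgn i * pow q (r ℕ.* i) * (a i * h (m ∸ i)))
    term i = begin
      ι (r !) * (sgn (r ℕ.+ i ℕ.+ r) * B * (f (r ℕ.+ i) * pow q ((r ℕ.+ i) C 2) * h (r ℕ.+ m ∸ (r ℕ.+ i))))
        ≈⟨ *-congˡ (*-cong (*-congʳ (sgn-cancel r i)) (*-cong (*-congˡ (pow-C2 i)) (reflexive (cong h (ℕₚ.[m+n]∸[m+o]≡n∸o r m i))))) ⟩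
      ι (r !) * (sgn i * B * (f (r ℕ.+ i) * (pow q (r C 2) * (pow q (i C 2) * pow q (r ℕ.* i))) * h (m ∸ i)))
        ≈⟨ solve 8 (λ n s b f x y z h → n :* (s :* b :* (f :* (x :* (y :* z)) :* h)) := x :* (s :* z :* (n :* (b :* f) :* y :* h))) refl
             (ι (r !)) (sgn i) B (f (r ℕ.+ i)) (pow q (r C 2)) (pow q (i C 2)) (pow q (r ℕ.* i)) (h (m ∸ i)) ⟩
      pow q (r C 2) * (sgn i * pow q (r ℕ.* i) * (ι (r !) * (B * f (r ℕ.+ i)) * pow q (i C 2) * h (m ∸ i)))
        ≈⟨ *-congˡ (*-congˡ (*-congʳ (*-congʳ (factorial-C-f r i)))) ⟩
      pow q (r C 2) * (sgn i * pow q (r ℕ.* i) * (a i * h (m ∸ i))) ∎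
      where
      B : Carrier
      B = ι ((r ℕ.+ i) C r)

  -- Σ_j P_M^(j) u^j = [t^M] E((u-1)t)/E(-t), at u = 1 - q^r.
  sum-P : ∀ M r → sum (suc M) (λ j → pow (p * [ r ]) j * P M j) ≈ G M r
  sum-P M r = begin
    sum (suc M) (λ j → pow y j * P M j)
      ≈⟨ sum-cong (suc M) {f = λ j → pow y j * P M j} (λ j _ → sum-distribˡ (suc M) (pow y j) (λ i → sgn (i ℕ.+ j) * ι (i C j) * (a i * h (M ∸ i)))) ⟩
    sum (suc M) (λ j → sum (suc M) (λ i → pow y j * (sgn (i ℕ.+ j) * ι (i C j) * (a i * h (M ∸ i)))))
      ≈⟨ sum-swap (suc M) (suc M) (λ j i → pow y j * (sgn (i ℕ.+ j) * ι (i C j) * (a i * h (M ∸ i)))) ⟩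
    sum (suc M) (λ i → sum (suc M) (λ j → pow y j * (sgn (i ℕ.+ j) * ι (i C j) * (a i * h (M ∸ i)))))
      -- For fixed i the sum over j is the expansion of (u-1)^i, which is (-q^r)^i at u = 1 - q^r.
      ≈⟨ sum-cong (suc M) (λ { i (s≤s i≤M) → inner i i≤M }) ⟩
    G M r ∎
    where
    y : Carrier
    y = p * [ r ]
    1+sy : 1# + s * y ≈ pow q r
    1+sy = begin
      1# + s * y                       ≈⟨ +-congˡ (*-congˡ (p*[r] r)) ⟩
      1# + s * (1# + s * pow q r)      ≈⟨ solve 2 (λ s x → con 1 :+ s :* (con 1 :+ s :* x) := con 1 :+ s :+ s :* s :* x) refl s (pow q r) ⟩
      1# + s + s * s * pow q r         ≈⟨ +-cong 1+s≈0 (trans (*-congʳ s*s≈1) (*-identityˡ _)) ⟩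
      0# + pow q r                     ≈⟨ +-identityˡ _ ⟩
      pow q r                          ∎
    inner : ∀ i → i ≤ M → sum (suc M) (λ j → pow y j * (sgn (i ℕ.+ j) * ι (i C j) * (a i * h (M ∸ i)))) ≈
      sgn i * pow q (r ℕ.* i) * (a i * h (M ∸ i))
    inner i i≤M = begin
      sum (suc M) (λ j → pow y j * (sgn (i ℕ.+ j) * ι (i C j) * A))
        ≈⟨ sum-cong (suc M) (λ j _ → term j) ⟩
      sum (suc M) (λ j → sgn i * A * (ι (i C j) * pow (s * y) j))
        ≈⟨ sum-distribˡ (suc M) (sgn i * A) (λ j → ι (i C j) * pow (s * y) j) ⟨
      sgn i * A * sum (suc M) (λ j → ι (i C j) * pow (s * y) j)
        ≈⟨ *-congˡ (trans (binomial M i (s * y) i≤M) (trans (pow-cong i 1+sy) (pow-pow q r i))) ⟩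
      sgn i * A * pow q (r ℕ.* i)
        ≈⟨ solve 3 (λ x y z → x :* y :* z := x :* z :* y) refl (sgn i) A _ ⟩
      sgn i * pow q (r ℕ.* i) * A ∎
      where
      A : Carrier
      A = a i * h (M ∸ i)
      term : ∀ j → pow y j * (sgn (i ℕ.+ j) * ι (i C j) * A) ≈ sgn i * A * (ι (i C j) * pow (s * y) j)
      term j = begin
        pow y j * (sgn (i ℕ.+ j) * ι (i C j) * A)
          ≈⟨ *-congˡ (*-congʳ (*-congʳ (pow-+ s i j))) ⟩
        pow y j * (sgn i * sgn j * ι (i C j) * A)
          ≈⟨ solve 5 (λ y s t c a → y :* (s :* t :* c :* a) := s :* a :* (c :* (t :* y))) refl (pow y j) (sgn i) (sgn j) (ι (i C j)) A ⟩
        sgn i * A * (ι (i C j) * (sgn j * pow y j))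
          ≈⟨ *-congˡ (*-congˡ (pow-* s y j)) ⟨
        sgn i * A * (ι (i C j) * pow (s * y) j) ∎

  -- By `sum-P`, G_m(r) is a sum of ((1-q)[r])^j P_m^(j), and `factorial-P` turns P_m^(j) into
  -- G_(m-j)(j). The induction hypothesis supplies (1-q)^(m-j), which the factor (1-q)^j completes
  -- to (1-q)^m, and m! = C(m,j) j! (m-j)! distributes the factorials. The bound `b` makes this
  -- strong induction structural.
  factorial-G : ∀ b m r → m ≤ b → ι (m !) * G m r ≈ pow p m * J m r
  factorial-G b zero r _ = begin
    ι 1 * (1# * pow q (r ℕ.* 0) * (f 0 * 1# * h 0) + 0#)
      ≈⟨ *-congˡ (+-congʳ (*-cong (*-congˡ (reflexive (cong (pow q) (ℕₚ.*-zeroʳ r)))) (*-congˡ h₀≈1))) ⟩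
    ι 1 * (1# * 1# * (f 0 * 1# * 1#) + 0#)
      ≈⟨ solve 2 (λ n f → n :* (con 1 :* con 1 :* (f :* con 1 :* con 1) :+ con 0) := n :* f) refl (ι 1) (f 0) ⟩
    ι 1 * f 0
      ≈⟨ f!≈1 0 ⟩
    1#
      ≈⟨ trans (*-identityˡ _) (J-zero r) ⟨
    1# * J 0 r ∎
  factorial-G (suc b) (suc m) r (s≤s m≤b) = sym (begin
    pow p M * J M r
      ≈⟨ *-congˡ (J-suc m r) ⟩
    pow p M * sum M (λ i → pow [ r ] (suc i) * (ι (M C suc i) * pow q (suc i C 2) * J (m ∸ i) (suc i)))
      ≈⟨ sum-distribˡ M (pow p M) (λ i → pow [ r ] (suc i) * (ι (M C suc i) * pow q (suc i C 2) * J (m ∸ i) (suc i))) ⟩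
    sum M (λ i → pow p M * (pow [ r ] (suc i) * (ι (M C suc i) * pow q (suc i C 2) * J (m ∸ i) (suc i))))
      ≈⟨ sum-cong M (λ { i (s≤s i≤m) → term i i≤m }) ⟩
    sum M (λ i → ι (M !) * (pow (p * [ r ]) (suc i) * P M (suc i)))
      ≈⟨ sum-distribˡ M (ι (M !)) (λ i → pow (p * [ r ]) (suc i) * P M (suc i)) ⟨
    ι (M !) * sum M (λ i → pow (p * [ r ]) (suc i) * P M (suc i))
      -- The term j = 0 is added; it vanishes by `P₀≈0` because M is positive.
      ≈⟨ *-congˡ (trans (+-congʳ (trans (*-congˡ (P₀≈0 m)) (zeroʳ _))) (+-identityˡ _)) ⟨
    ι (M !) * sum (suc M) (λ j → pow (p * [ r ]) j * P M j)
      ≈⟨ *-congˡ (sum-P M r) ⟩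
    ι (M !) * G M r ∎)
    where
    M : ℕ
    M = suc m
    term : ∀ i → i ≤ m → pow p M * (pow [ r ] (suc i) * (ι (M C suc i) * pow q (suc i C 2) * J (m ∸ i) (suc i))) ≈
      ι (M !) * (pow (p * [ r ]) (suc i) * P M (suc i))
    term i i≤m = begin
      pow p M * (Y * (B * Q * J k j))
        ≈⟨ *-congʳ (trans (reflexive (cong (pow p) (≡.sym j+k≡M))) (pow-+ p j k)) ⟩
      pow p j * pow p k * (Y * (B * Q * J k j))
        ≈⟨ solve 6 (λ a b y c q z → a :* b :* (y :* (c :* q :* z)) := (a :* y) :* (c :* q) :* (b :* z)) refl (pow p j) (pow p k) Y B Q (J k j) ⟩
      (pow p j * Y) * (B * Q) * (pow p k * J k j)
        ≈⟨ *-cong (*-congʳ (sym (pow-* p [ r ] j))) (sym (factorial-G b k j (ℕₚ.≤-trans (ℕₚ.m∸n≤m m i) m≤b))) ⟩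
      Z * (B * Q) * (ι (k !) * G k j)
        ≈⟨ solve 5 (λ z b q k g → z :* (b :* q) :* (k :* g) := z :* b :* k :* (q :* g)) refl Z B Q (ι (k !)) (G k j) ⟩
      Z * B * ι (k !) * (Q * G k j)
        ≈⟨ *-congˡ (trans (sym (factorial-P j k)) (reflexive (cong (λ n → ι (j !) * P n j) j+k≡M))) ⟩
      Z * B * ι (k !) * (ι (j !) * P M j)
        ≈⟨ solve 5 (λ z b k j x → z :* b :* k :* (j :* x) := b :* (j :* k) :* (z :* x)) refl Z B (ι (k !)) (ι (j !)) (P M j) ⟩
      B * (ι (j !) * ι (k !)) * (Z * P M j)
        ≈⟨ *-congʳ (trans (*-congˡ (sym (ι-* (j !) (k !)))) (sym (ι-* (M C j) (j ! ℕ.* k !)))) ⟩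
      ι ((M C j) ℕ.* (j ! ℕ.* k !)) * (Z * P M j)
        ≡⟨ cong (λ n → ι n * (Z * P M j)) (≡.subst (λ n → (n C j) ℕ.* (j ! ℕ.* k !) ≡ n !) j+k≡M (C-factorial j k)) ⟩
      ι (M !) * (Z * P M j) ∎
      where
      j k : ℕ
      j = suc i
      k = m ∸ i
      j+k≡M : j ℕ.+ k ≡ M
      j+k≡M = cong suc (ℕₚ.m+[n∸m]≡n i≤m)
      Y B Q Z : Carrier
      Y = pow [ r ] j
      B = ι (M C j)
      Q = pow q (j C 2)
      Z = pow (p * [ r ]) j

  factorial-factorial-P : ∀ r m → ι (r ! ℕ.* m !) * P (r ℕ.+ m) r ≈ pow p m * (pow q (r C 2) * J m r)
  factorial-factorial-P r m = begin
    ι (r ! ℕ.* m !) * P (r ℕ.+ m) r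
      ≈⟨ *-congʳ (ι-* (r !) (m !)) ⟩
    ι (r !) * ι (m !) * P (r ℕ.+ m) r
      ≈⟨ solve 3 (λ a b c → a :* b :* c := b :* (a :* c)) refl (ι (r !)) (ι (m !)) _ ⟩
    ι (m !) * (ι (r !) * P (r ℕ.+ m) r)
      ≈⟨ *-congˡ (factorial-P r m) ⟩
    ι (m !) * (pow q (r C 2) * G m r)
      ≈⟨ solve 3 (λ a b c → a :* (b :* c) := b :* (a :* c)) refl (ι (m !)) (pow q (r C 2)) (G m r) ⟩
    pow q (r C 2) * (ι (m !) * G m r)
      ≈⟨ *-congˡ (factorial-G m m r ℕₚ.≤-refl) ⟩
    pow q (r C 2) * (pow p m * J m r)
      ≈⟨ solve 3 (λ a b c → a :* (b :* c) := b :* (a :* c)) refl (pow q (r C 2)) (pow p m) (J m r) ⟩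
    pow p m * (pow q (r C 2) * J m r) ∎

-- Linear extension from words to expressions in the e's.

-- The linear extension `lin` serves two purposes: over ℤ it extracts the coefficient of x^α, over
-- ℚ[[q]] it computes φ. Abstracting the map from ℤ lets both share the same lemmas.
record Scalars (R : CommutativeRing 0ℓ 0ℓ) : Set where
  open CommutativeRing R
  field
    ρ   : ℤ → Carrier
    ρ-+ : ∀ c d → ρ (c ℤ.+ d) ≈ ρ c + ρ d
    ρ-* : ∀ c d → ρ (c ℤ.* d) ≈ ρ c * ρ d
    ρ-1 : ρ ℤ.1ℤ ≈ 1#

neg : EExpr → EExpr
neg = map (λ { (c , μ) → (ℤ.- c , μ) })

mulE : ℤ → ℕ → EExpr → EExpr
mulE c m = map (λ { (d , μ) → (c ℤ.* d , m ∷ μ) })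

sumE : ℕ → (ℕ → EExpr) → EExpr
sumE zero    F = []
sumE (suc n) F = F 0 ++ sumE n (F ∘ suc)

total : EExpr → ℤ
total []            = ℤ.0ℤ
total ((c , _) ∷ E) = c ℤ.+ total E

module Linear (R : CommutativeRing 0ℓ 0ℓ) (scalars : Scalars R) where
  open CommutativeRing R hiding (zero)
  open Scalars scalars public
  open Sums R
  open GroupProperties +-group using (identityʳ-unique; inverseʳ-unique)
  open NaturalCoefficients commutativeSemiring using (solve; _:+_; _:*_; _:=_)

  ρ-0 : ρ ℤ.0ℤ ≈ 0#
  ρ-0 = identityʳ-unique (ρ ℤ.0ℤ) (ρ ℤ.0ℤ) (sym (ρ-+ ℤ.0ℤ ℤ.0ℤ))

  ρ-neg : ∀ c → ρ (ℤ.- c) ≈ - ρ c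
  ρ-neg c = inverseʳ-unique (ρ c) (ρ (ℤ.- c))
    (trans (sym (ρ-+ c (ℤ.- c))) (trans (reflexive (cong ρ (ℤₚ.+-inverseʳ c))) ρ-0))

  lin : (List ℕ → Carrier) → EExpr → Carrier
  lin f []            = 0#
  lin f ((c , μ) ∷ E) = ρ c * f μ + lin f E

  lin-cong : ∀ {f g} → (∀ μ → f μ ≈ g μ) → ∀ E → lin f E ≈ lin g E
  lin-cong f≈g []            = refl
  lin-cong f≈g ((c , μ) ∷ E) = +-cong (*-congˡ (f≈g μ)) (lin-cong f≈g E)

  lin-++ : ∀ f E F → lin f (E ++ F) ≈ lin f E + lin f F
  lin-++ f []            F = sym (+-identityˡ _)
  lin-++ f ((c , μ) ∷ E) F = trans (+-congˡ (lin-++ f E F)) (sym (+-assoc _ _ _))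

  lin-+ : ∀ f g E → lin (λ μ → f μ + g μ) E ≈ lin f E + lin g E
  lin-+ f g []            = sym (+-identityˡ _)
  lin-+ f g ((c , μ) ∷ E) = trans (+-congˡ (lin-+ f g E))
    (solve 5 (λ c x y a b → c :* (x :+ y) :+ (a :+ b) := (c :* x :+ a) :+ (c :* y :+ b)) refl
      (ρ c) (f μ) (g μ) (lin f E) (lin g E))

  lin-* : ∀ a f E → lin (λ μ → a * f μ) E ≈ a * lin f E
  lin-* a f []            = sym (zeroʳ a)
  lin-* a f ((c , μ) ∷ E) = trans (+-congˡ (lin-* a f E))
    (solve 4 (λ c a x l → c :* (a :* x) :+ a :* l := a :* (c :* x :+ l)) refl (ρ c) a (f μ) (lin f E))

  lin-zero : ∀ {f} E → All (λ t → f (proj₂ t) ≈ 0#) E → lin f E ≈ 0#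
  lin-zero []            []          = refl
  lin-zero ((c , μ) ∷ E) (f≈0 ∷ fs≈0) = trans
    (+-cong (trans (*-congˡ f≈0) (zeroʳ _)) (lin-zero E fs≈0)) (+-identityˡ 0#)

  lin-const : ∀ {f} x E → All (λ t → f (proj₂ t) ≈ x) E → lin f E ≈ ρ (total E) * x
  lin-const x []            []           = sym (trans (*-congʳ ρ-0) (zeroˡ x))
  lin-const x ((c , μ) ∷ E) (f≈x ∷ fs≈x) = trans (+-cong (*-congˡ f≈x) (lin-const x E fs≈x))
    (trans (sym (distribʳ x _ _)) (*-congʳ (sym (ρ-+ c (total E)))))

  lin-neg : ∀ f E → lin f (neg E) ≈ - lin f E
  lin-neg f E = inverseʳ-unique (lin f E) (lin f (neg E)) (cancel E)
    where
    cancel : ∀ E → lin f E + lin f (neg E) ≈ 0#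
    cancel []            = +-identityˡ 0#
    cancel ((c , μ) ∷ E) = trans (interchange _ _ _ _) (trans
      (+-cong (trans (sym (distribʳ (f μ) _ _)) (trans (*-congʳ (trans (+-congˡ (ρ-neg c)) (-‿inverseʳ (ρ c)))) (zeroˡ _))) (cancel E))
      (+-identityˡ 0#))

  lin-mulE : ∀ f c m E → lin f (mulE c m E) ≈ ρ c * lin (f ∘ (m ∷_)) E
  lin-mulE f c m []            = sym (zeroʳ _)
  lin-mulE f c m ((d , μ) ∷ E) = trans (+-cong (*-congʳ (ρ-* c d)) (lin-mulE f c m E))
    (solve 4 (λ c d x l → c :* d :* x :+ c :* l := c :* (d :* x :+ l)) refl (ρ c) (ρ d) (f (m ∷ μ)) _)

  lin-sumE : ∀ f n F → lin f (sumE n F) ≈ sum n (λ i → lin f (F i))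
  lin-sumE f zero    F = refl
  lin-sumE f (suc n) F = trans (lin-++ f (F 0) _) (+-congˡ (lin-sumE f n (F ∘ suc)))

  lin-filter : ∀ {P : ℤ × List ℕ → Set} (P? : Decidable P) f E →
    lin f E ≈ lin f (filter P? E) + lin f (filter (¬? ∘ P?) E)
  lin-filter P? f []            = sym (+-identityˡ _)
  lin-filter P? f ((c , μ) ∷ E) with P? (c , μ)
  ... | yes _ = trans (+-congˡ (lin-filter P? f E)) (sym (+-assoc _ _ _))
  ... | no  _ = trans (+-congˡ (lin-filter P? f E))
    (solve 3 (λ x y z → x :+ (y :+ z) := y :+ (x :+ z)) refl _ _ _)

  ρ-sgn : ∀ n → ρ (Sums.sgn ℤₚ.+-*-commutativeRing n) ≈ sgn n
  ρ-sgn zero    = ρ-1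
  ρ-sgn (suc n) = trans (ρ-* _ _) (*-cong (trans (ρ-neg ℤ.1ℤ) (-‿cong ρ-1)) (ρ-sgn n))

  ρ-ι : ∀ n → ρ (Sums.ι ℤₚ.+-*-commutativeRing n) ≈ ι n
  ρ-ι zero    = ρ-0
  ρ-ι (suc n) = trans (ρ-+ _ _) (+-cong ρ-1 (ρ-ι n))

module Sℤ = Sums ℤₚ.+-*-commutativeRing

ℤ-scalars : Scalars ℤₚ.+-*-commutativeRing
ℤ-scalars = record { ρ = id ; ρ-+ = λ _ _ → ≡.refl ; ρ-* = λ _ _ → ≡.refl ; ρ-1 = ≡.refl }

module Lℤ = Linear ℤₚ.+-*-commutativeRing ℤ-scalars

-- Products of elementary symmetric polynomials through their coefficients.

module Coefficients where
  open ≡.≡-Reasoning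

  -- A symmetric function is handled through its coefficients α ↦ [x^α].
  Coeffs : ℕ → Set
  Coeffs N = Vec ℕ N → ℤ

  -- Multiplication by x^b seen on exponents of the first variable: the value at a - b, or zero if b
  -- > a. Comparison and subtraction form a single recursion.
  low : ∀ {N} → ℕ → ℕ → (ℕ → Coeffs N) → Coeffs N
  low zero    a       g = g a
  low (suc b) zero    g = λ _ → ℤ.0ℤ
  low (suc b) (suc a) g = low b a g

  curry : ∀ {N} → Coeffs (suc N) → ℕ → Coeffs N
  curry g a α = g (a ∷ α)

  -- Coefficients of x^β · g.
  monomialMul : ∀ {N} → Vec ℕ N → Coeffs N → Coeffs N
  monomialMul []      g []      = g []
  monomialMul (b ∷ β) g (a ∷ α) = monomialMul β (low b a (curry g)) α

  -- Coefficients of e_k · g, from e_{k+1}(x, y, …) = e_{k+1}(y, …) + x e_k(y, …).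
  elemMul : ∀ {N} → ℕ → Coeffs N → Coeffs N
  elemMul zero    g α       = g α
  elemMul (suc k) g []      = ℤ.0ℤ
  elemMul (suc k) g (a ∷ α) = elemMul (suc k) (curry g a) α ℤ.+ elemMul k (low 1 a (curry g)) α

  unit : ∀ {N} → Coeffs N
  unit []          = ℤ.1ℤ
  unit (zero ∷ α)  = unit α
  unit (suc _ ∷ α) = ℤ.0ℤ

  elemWord : ∀ {N} → List ℕ → Coeffs N
  elemWord []      = unit
  elemWord (k ∷ μ) = elemMul k (elemWord μ)

  low-cong : ∀ {N} b a {g h : ℕ → Coeffs N} → (∀ c → g c ≗ h c) → low b a g ≗ low b a h
  low-cong zero    a       g≗h = g≗h a
  low-cong (suc b) zero    g≗h = λ _ → ≡.refl
  low-cong (suc b) (suc a) g≗h = low-cong b a g≗h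

  low-zero : ∀ {N} b a {g : ℕ → Coeffs N} → (∀ c α → g c α ≡ ℤ.0ℤ) → ∀ α → low b a g α ≡ ℤ.0ℤ
  low-zero zero    a       g≡0 = g≡0 a
  low-zero (suc b) zero    g≡0 = λ _ → ≡.refl
  low-zero (suc b) (suc a) g≡0 = low-zero b a g≡0

  low-+ : ∀ {N} b a (g h : ℕ → Coeffs N) → low b a (λ c γ → g c γ ℤ.+ h c γ) ≗ λ α → low b a g α ℤ.+ low b a h α
  low-+ zero    a       g h α = ≡.refl
  low-+ (suc b) zero    g h α = ≡.refl
  low-+ (suc b) (suc a) g h α = low-+ b a g h α

  low-* : ∀ {N} x b a (g : ℕ → Coeffs N) → low b a (λ c γ → x ℤ.* g c γ) ≗ λ α → x ℤ.* low b a g α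
  low-* x zero    a       g α = ≡.refl
  low-* x (suc b) zero    g α = ≡.sym (ℤₚ.*-zeroʳ x)
  low-* x (suc b) (suc a) g α = low-* x b a g α

  monomialMul-cong : ∀ {N} (β : Vec ℕ N) {g h} → g ≗ h → monomialMul β g ≗ monomialMul β h
  monomialMul-cong []      g≗h []      = g≗h []
  monomialMul-cong (b ∷ β) g≗h (a ∷ α) = monomialMul-cong β (low-cong b a (λ c γ → g≗h (c ∷ γ))) α

  monomialMul-zero : ∀ {N} (β : Vec ℕ N) {g} → (∀ α → g α ≡ ℤ.0ℤ) → ∀ α → monomialMul β g α ≡ ℤ.0ℤ
  monomialMul-zero []      g≡0 []      = g≡0 []
  monomialMul-zero (b ∷ β) g≡0 (a ∷ α) = monomialMul-zero β (low-zero b a (λ c γ → g≡0 (c ∷ γ))) α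

  elemMul-cong : ∀ {N} k {g h : Coeffs N} → g ≗ h → elemMul k g ≗ elemMul k h
  elemMul-cong zero    g≗h α       = g≗h α
  elemMul-cong (suc k) g≗h []      = ≡.refl
  elemMul-cong (suc k) g≗h (a ∷ α) = cong₂ ℤ._+_ (elemMul-cong (suc k) (λ γ → g≗h (a ∷ γ)) α)
    (elemMul-cong k (low-cong 1 a (λ c γ → g≗h (c ∷ γ))) α)

  elemMul-zero : ∀ {N} k {g : Coeffs N} → (∀ α → g α ≡ ℤ.0ℤ) → ∀ α → elemMul k g α ≡ ℤ.0ℤ
  elemMul-zero zero    g≡0 α       = g≡0 α
  elemMul-zero (suc k) g≡0 []      = ≡.refl
  elemMul-zero (suc k) g≡0 (a ∷ α) = cong₂ ℤ._+_ (elemMul-zero (suc k) (λ γ → g≡0 (a ∷ γ)) α)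
    (elemMul-zero k (low-zero 1 a (λ c γ → g≡0 (c ∷ γ))) α)

  elemMul-+ : ∀ {N} k (g h : Coeffs N) → elemMul k (λ α → g α ℤ.+ h α) ≗ λ α → elemMul k g α ℤ.+ elemMul k h α
  elemMul-+ zero    g h α       = ≡.refl
  elemMul-+ (suc k) g h []      = ≡.refl
  elemMul-+ (suc k) g h (a ∷ α) = ≡.trans
    (cong₂ ℤ._+_ (elemMul-+ (suc k) (curry g a) (curry h a) α)
      (≡.trans (elemMul-cong k (low-+ 1 a (curry g) (curry h)) α) (elemMul-+ k (low 1 a (curry g)) (low 1 a (curry h)) α)))
    (Sℤ.interchange (elemMul (suc k) (curry g a) α) (elemMul (suc k) (curry h a) α) _ _)

  elemMul-* : ∀ {N} x k (g : Coeffs N) → elemMul k (λ α → x ℤ.* g α) ≗ λ α → x ℤ.* elemMul k g α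
  elemMul-* x zero    g α       = ≡.refl
  elemMul-* x (suc k) g []      = ≡.sym (ℤₚ.*-zeroʳ x)
  elemMul-* x (suc k) g (a ∷ α) = ≡.trans
    (cong₂ ℤ._+_ (elemMul-* x (suc k) (curry g a) α)
      (≡.trans (elemMul-cong k (low-* x 1 a (curry g)) α) (elemMul-* x k (low 1 a (curry g)) α)))
    (≡.sym (ℤₚ.*-distribˡ-+ x _ _))

  -- Splitting off the first variable x in both factors gives four products in the remaining
  -- variables, the same for both orders up to exchanging the two mixed ones. `g₀`, `g₁`, `g₂` are
  -- the parts of `g` at x^a, x^(a-1), x^(a-2).
  elemMul-comm : ∀ {N} k l (g : Coeffs N) → elemMul k (elemMul l g) ≗ elemMul l (elemMul k g)
  elemMul-comm zero    l       g α       = ≡.refl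
  elemMul-comm (suc k) zero    g α       = ≡.refl
  elemMul-comm (suc k) (suc l) g []      = ≡.refl
  elemMul-comm (suc k) (suc l) g (a ∷ α) = begin
    elemMul (suc k) (elemMul (suc l) g) (a ∷ α)
      ≡⟨ expand k l ⟩
    (elemMul (suc k) (elemMul (suc l) g₀) α ℤ.+ elemMul (suc k) (elemMul l g₁) α) ℤ.+
    (elemMul k (elemMul (suc l) g₁) α ℤ.+ elemMul k (elemMul l g₂) α)
      ≡⟨ Sℤ.interchange (elemMul (suc k) (elemMul (suc l) g₀) α) _ _ _ ⟩
    (elemMul (suc k) (elemMul (suc l) g₀) α ℤ.+ elemMul k (elemMul (suc l) g₁) α) ℤ.+
    (elemMul (suc k) (elemMul l g₁) α ℤ.+ elemMul k (elemMul l g₂) α)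
      ≡⟨ cong₂ ℤ._+_
           (cong₂ ℤ._+_ (elemMul-comm (suc k) (suc l) g₀ α) (elemMul-comm k (suc l) g₁ α))
           (cong₂ ℤ._+_ (elemMul-comm (suc k) l g₁ α) (elemMul-comm k l g₂ α)) ⟩
    (elemMul (suc l) (elemMul (suc k) g₀) α ℤ.+ elemMul (suc l) (elemMul k g₁) α) ℤ.+
    (elemMul l (elemMul (suc k) g₁) α ℤ.+ elemMul l (elemMul k g₂) α)
      ≡⟨ expand l k ⟨
    elemMul (suc l) (elemMul (suc k) g) (a ∷ α) ∎
    where
    g₀ g₁ g₂ : Coeffs _
    g₀ = curry g a
    g₁ = low 1 a (curry g)
    g₂ = low 1 a (λ b → low 1 b (curry g))
    low-elemMul : ∀ l a → low 1 a (curry (elemMul (suc l) g)) ≗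
      λ β → elemMul (suc l) (low 1 a (curry g)) β ℤ.+ elemMul l (low 1 a (λ b → low 1 b (curry g))) β
    low-elemMul l zero    β = ≡.sym (cong₂ ℤ._+_ (elemMul-zero (suc l) (λ _ → ≡.refl) β) (elemMul-zero l (λ _ → ≡.refl) β))
    low-elemMul l (suc a) β = ≡.refl
    expand : ∀ k l → elemMul (suc k) (elemMul (suc l) g) (a ∷ α) ≡
      (elemMul (suc k) (elemMul (suc l) g₀) α ℤ.+ elemMul (suc k) (elemMul l g₁) α) ℤ.+
      (elemMul k (elemMul (suc l) g₁) α ℤ.+ elemMul k (elemMul l g₂) α)
    expand k l = cong₂ ℤ._+_ (elemMul-+ (suc k) (elemMul (suc l) g₀) (elemMul l g₁) α)
      (≡.trans (elemMul-cong k (low-elemMul l a) α) (elemMul-+ k (elemMul (suc l) g₁) (elemMul l g₂) α))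

  elemMul-lin : ∀ {N} k (g : List ℕ → Coeffs N) E α →
    Lℤ.lin (λ μ → elemMul k (g μ) α) E ≡ elemMul k (λ β → Lℤ.lin (λ μ → g μ β) E) α
  elemMul-lin k g []            α = ≡.sym (elemMul-zero k (λ _ → ≡.refl) α)
  elemMul-lin k g ((c , μ) ∷ E) α = ≡.trans
    (cong₂ ℤ._+_ (≡.sym (elemMul-* c k (g μ) α)) (elemMul-lin k g E α))
    (≡.sym (elemMul-+ k (λ β → c ℤ.* g μ β) (λ β → Lℤ.lin (λ μ → g μ β) E) α))

  mcoeff-++ : ∀ {N} (p q : MPoly N) α → mcoeff (p ++ q) α ≡ mcoeff p α ℤ.+ mcoeff q α
  mcoeff-++ []            q α = ≡.sym (ℤₚ.+-identityˡ _)
  mcoeff-++ ((c , β) ∷ p) q α with does (≡-dec ℕ._≟_ β α)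
  ... | true  = ≡.trans (cong (λ z → c ℤ.+ z) (mcoeff-++ p q α)) (≡.sym (ℤₚ.+-assoc c _ _))
  ... | false = mcoeff-++ p q α

  mcoeff-scale : ∀ {N} c (p : MPoly N) α → mcoeff (map (λ { (d , β) → (c ℤ.* d , β) }) p) α ≡ c ℤ.* mcoeff p α
  mcoeff-scale c []            α = ≡.sym (ℤₚ.*-zeroʳ c)
  mcoeff-scale c ((d , β) ∷ p) α with does (≡-dec ℕ._≟_ β α)
  ... | true  = ≡.trans (cong (λ z → c ℤ.* d ℤ.+ z) (mcoeff-scale c p α)) (≡.sym (ℤₚ.*-distribˡ-+ c d _))
  ... | false = mcoeff-scale c p α

  -- The effect on coefficients of one further term of an `MPoly`, in the shape to which `mcoeff`
  -- unfolds.
  insert : ∀ {N} → ℤ → Vec ℕ N → Coeffs N → Coeffs N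
  insert d γ h α = if does (≡-dec ℕ._≟_ γ α) then d ℤ.+ h α else h α

  monomialMul-insert : ∀ {N} d (β γ : Vec ℕ N) h α →
    monomialMul β (insert d γ h) α ≡ insert d (Vec.zipWith ℕ._+_ β γ) (monomialMul β h) α
  monomialMul-insert d []      []      h []      = ≡.refl
  monomialMul-insert d (b ∷ β) (c ∷ γ) h (a ∷ α) = go b a (curry h)
    where
    -- On nonempty vectors `does (≡-dec ...)` computes to this conjunction, and `b` and `a` can be
    -- lowered together.
    go : ∀ b a (h : ℕ → Coeffs _) →
      monomialMul β (low b a (λ a γ′ → if (c ℕ.≡ᵇ a) ∧ does (≡-dec ℕ._≟_ γ γ′) then d ℤ.+ h a γ′ else h a γ′)) α ≡
      (if ((b ℕ.+ c) ℕ.≡ᵇ a) ∧ does (≡-dec ℕ._≟_ (Vec.zipWith ℕ._+_ β γ) α)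
        then d ℤ.+ monomialMul β (low b a h) α else monomialMul β (low b a h) α)
    go zero a h with c ℕ.≡ᵇ a
    ... | true  = monomialMul-insert d β γ (h a) α
    ... | false = ≡.refl
    go (suc b) zero    h = ≡.refl
    go (suc b) (suc a) h = go b a h

  mcoeff-monomialMul : ∀ {N} (β : Vec ℕ N) p α →
    mcoeff (map (λ { (d , γ) → (ℤ.1ℤ ℤ.* d , Vec.zipWith ℕ._+_ β γ) }) p) α ≡ monomialMul β (mcoeff p) α
  mcoeff-monomialMul β []            α = ≡.sym (monomialMul-zero β (λ _ → ≡.refl) α)
  mcoeff-monomialMul β ((d , γ) ∷ p) α = begin
    _ ≡⟨ cong (λ x → if does (≡-dec ℕ._≟_ (Vec.zipWith ℕ._+_ β γ) α) then ℤ.1ℤ ℤ.* d ℤ.+ x else x) (mcoeff-monomialMul β p α) ⟩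
    insert (ℤ.1ℤ ℤ.* d) (Vec.zipWith ℕ._+_ β γ) (monomialMul β (mcoeff p)) α
      ≡⟨ cong (λ x → insert x (Vec.zipWith ℕ._+_ β γ) (monomialMul β (mcoeff p)) α) (ℤₚ.*-identityˡ d) ⟩
    insert d (Vec.zipWith ℕ._+_ β γ) (monomialMul β (mcoeff p)) α
      ≡⟨ monomialMul-insert d β γ (mcoeff p) α ⟨
    monomialMul β (insert d γ (mcoeff p)) α ∎

  -- An intermediate form between `mmul (elem N k)`, which runs through the listed monomials, and
  -- the recursive `elemMul`.
  sumMonomialMul : ∀ {N} → List (Vec ℕ N) → Coeffs N → Coeffs N
  sumMonomialMul []       g α = ℤ.0ℤ
  sumMonomialMul (β ∷ βs) g α = monomialMul β g α ℤ.+ sumMonomialMul βs g α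

  sumMonomialMul-++ : ∀ {N} (βs γs : List (Vec ℕ N)) g α →
    sumMonomialMul (βs ++ γs) g α ≡ sumMonomialMul βs g α ℤ.+ sumMonomialMul γs g α
  sumMonomialMul-++ []       γs g α = ≡.sym (ℤₚ.+-identityˡ _)
  sumMonomialMul-++ (β ∷ βs) γs g α =
    ≡.trans (cong (λ z → monomialMul β g α ℤ.+ z) (sumMonomialMul-++ βs γs g α))
      (≡.sym (ℤₚ.+-assoc (monomialMul β g α) _ _))

  sumMonomialMul-cons : ∀ {N} b (βs : List (Vec ℕ N)) g a α →
    sumMonomialMul (map (b ∷_) βs) g (a ∷ α) ≡ sumMonomialMul βs (low b a (curry g)) α
  sumMonomialMul-cons b []       g a α = ≡.refl
  sumMonomialMul-cons b (β ∷ βs) g a α = cong (λ z → monomialMul β (low b a (curry g)) α ℤ.+ z) (sumMonomialMul-cons b βs g a α)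

  sumMonomialMul-subsetVecs : ∀ {N} k (g : Coeffs N) α → sumMonomialMul (subsetVecs N k) g α ≡ elemMul k g α
  sumMonomialMul-subsetVecs {zero}  zero    g []      = ℤₚ.+-identityʳ _
  sumMonomialMul-subsetVecs {zero}  (suc k) g []      = ≡.refl
  sumMonomialMul-subsetVecs {suc N} zero    g (a ∷ α) = ≡.trans
    (sumMonomialMul-cons 0 (subsetVecs N zero) g a α) (sumMonomialMul-subsetVecs zero (curry g a) α)
  sumMonomialMul-subsetVecs {suc N} (suc k) g (a ∷ α) = ≡.trans
    (sumMonomialMul-++ (map (0 ∷_) (subsetVecs N (suc k))) _ g (a ∷ α))
    (cong₂ ℤ._+_
      (≡.trans (sumMonomialMul-cons 0 (subsetVecs N (suc k)) g a α) (sumMonomialMul-subsetVecs (suc k) (curry g a) α))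
      (≡.trans (sumMonomialMul-cons 1 (subsetVecs N k) g a α) (sumMonomialMul-subsetVecs k (low 1 a (curry g)) α)))

  mcoeff-mmul-elem : ∀ {N} k (p : MPoly N) α → mcoeff (mmul (elem N k) p) α ≡ elemMul k (mcoeff p) α
  mcoeff-mmul-elem {N} k p α = ≡.trans (go (subsetVecs N k)) (sumMonomialMul-subsetVecs k (mcoeff p) α)
    where
    go : ∀ βs → mcoeff (mmul (map (λ β → (ℤ.1ℤ , β)) βs) p) α ≡ sumMonomialMul βs (mcoeff p) α
    go []       = ≡.refl
    go (β ∷ βs) = ≡.trans (mcoeff-++ (map _ p) (mmul (map (λ β → (ℤ.1ℤ , β)) βs) p) α)
      (cong₂ ℤ._+_ (mcoeff-monomialMul β p α) (go βs))

  mcoeff-mone : ∀ {N} (α : Vec ℕ N) → mcoeff mone α ≡ unit α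
  mcoeff-mone []          = ≡.refl
  mcoeff-mone (zero ∷ α)  = mcoeff-mone α
  mcoeff-mone (suc _ ∷ α) = ≡.refl

  mcoeff-elemProd : ∀ {N} μ (α : Vec ℕ N) → mcoeff (elemProd N μ) α ≡ elemWord μ α
  mcoeff-elemProd     []      α = mcoeff-mone α
  mcoeff-elemProd {N} (k ∷ μ) α = ≡.trans (mcoeff-mmul-elem k (elemProd N μ) α)
    (elemMul-cong k (mcoeff-elemProd μ) α)

  coeffE : ∀ {N} → EExpr → Coeffs N
  coeffE E α = Lℤ.lin (λ μ → elemWord μ α) E

  mcoeff-evalE : ∀ {N} E (α : Vec ℕ N) → mcoeff (evalE N E) α ≡ coeffE E α
  mcoeff-evalE     []            α = ≡.refl
  mcoeff-evalE {N} ((c , μ) ∷ E) α = ≡.trans (mcoeff-++ (map _ (elemProd N μ)) (evalE N E) α)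
    (cong₂ ℤ._+_
      (≡.trans (mcoeff-scale c (elemProd N μ) α) (cong (λ z → c ℤ.* z) (mcoeff-elemProd μ α)))
      (mcoeff-evalE E α))

  coeffE-mulE : ∀ {N} c m E (α : Vec ℕ N) → coeffE (mulE c m E) α ≡ c ℤ.* elemMul m (coeffE E) α
  coeffE-mulE c m E α = ≡.trans (Lℤ.lin-mulE (λ μ → elemWord μ α) c m E)
    (cong (λ z → c ℤ.* z) (elemMul-lin m elemWord E α))

open Coefficients

-- Explicit expressions for h_n and p_n^(r).

module Existence where
  open ≡.≡-Reasoning
  open Sℤ using (δ; ι; sgn; sum)
  open NaturalCoefficients (CommutativeRing.commutativeSemiring ℤₚ.+-*-commutativeRing)
    using (solve; _:+_; _:*_; _:=_)

  -- A monomial of e_k dividing x^α is a choice of k of its nonzero exponents, and h_n has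
  -- coefficient 1 at each quotient of degree n. The offset `s` collects the exponents of variables
  -- already split off.
  elemMul-δ : ∀ {N} k s n (α : Vec ℕ N) →
    elemMul k (λ β → δ (s ℕ.+ vsum β) n) α ≡ δ (s ℕ.+ vsum α) (n ℕ.+ k) ℤ.* ι (nonzeros α C k)
  elemMul-δ zero    s n α = ≡.sym (≡.trans
    (cong (λ j → δ (s ℕ.+ vsum α) j ℤ.* ℤ.1ℤ) (ℕₚ.+-identityʳ n)) (ℤₚ.*-identityʳ (δ (s ℕ.+ vsum α) n)))
  elemMul-δ (suc k) s n [] = ≡.sym (ℤₚ.*-zeroʳ (δ (s ℕ.+ 0) (n ℕ.+ suc k)))
  elemMul-δ (suc k) s n (zero ∷ α) = ≡.trans (cong₂ ℤ._+_ (elemMul-δ (suc k) s n α) (elemMul-zero k (λ _ → ≡.refl) α))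
    (ℤₚ.+-identityʳ _)
  elemMul-δ (suc k) s n (suc a ∷ α) = begin
    elemMul (suc k) (λ β → δ (s ℕ.+ (suc a ℕ.+ vsum β)) n) α ℤ.+ elemMul k (λ β → δ (s ℕ.+ (a ℕ.+ vsum β)) n) α
      ≡⟨ cong₂ ℤ._+_ (at (suc k) (suc a)) (at k a) ⟩
    δ (s ℕ.+ (suc a ℕ.+ vsum α)) (n ℕ.+ suc k) ℤ.* ι (nonzeros α C suc k) ℤ.+
    δ (s ℕ.+ (a ℕ.+ vsum α)) (n ℕ.+ k) ℤ.* ι (nonzeros α C k)
      ≡⟨ cong (λ x → D ℤ.* ι (nonzeros α C suc k) ℤ.+ x ℤ.* ι (nonzeros α C k))
           (cong₂ δ (≡.sym (ℕₚ.+-suc s (a ℕ.+ vsum α))) (≡.sym (ℕₚ.+-suc n k))) ⟩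
    D ℤ.* ι (nonzeros α C suc k) ℤ.+ D ℤ.* ι (nonzeros α C k)
      ≡⟨ solve 3 (λ d x y → d :* x :+ d :* y := d :* (y :+ x)) ≡.refl D (ι (nonzeros α C suc k)) (ι (nonzeros α C k)) ⟩
    D ℤ.* (ι (nonzeros α C k) ℤ.+ ι (nonzeros α C suc k))
      ≡⟨ cong (λ x → D ℤ.* x) (Sℤ.ιC-suc (nonzeros α) k) ⟨
    D ℤ.* ι (suc (nonzeros α) C suc k) ∎
    where
    D : ℤ
    D = δ (s ℕ.+ (suc a ℕ.+ vsum α)) (n ℕ.+ suc k)
    at : ∀ k b → elemMul k (λ β → δ (s ℕ.+ (b ℕ.+ vsum β)) n) α ≡
      δ (s ℕ.+ (b ℕ.+ vsum α)) (n ℕ.+ k) ℤ.* ι (nonzeros α C k)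
    at k b = ≡.trans (elemMul-cong k (λ β → cong (λ x → δ x n) (≡.sym (ℕₚ.+-assoc s b (vsum β)))) α)
      (≡.trans (elemMul-δ k (s ℕ.+ b) n α)
        (cong (λ x → δ x (n ℕ.+ k) ℤ.* ι (nonzeros α C k)) (ℕₚ.+-assoc s b (vsum α))))

  nonzeros≤vsum : ∀ {N} (α : Vec ℕ N) → nonzeros α ≤ vsum α
  nonzeros≤vsum []          = z≤n
  nonzeros≤vsum (zero ∷ α)  = nonzeros≤vsum α
  nonzeros≤vsum (suc a ∷ α) = s≤s (ℕₚ.≤-trans (nonzeros≤vsum α) (ℕₚ.m≤n+m _ a))

  vsum≤0 : ∀ {N} (α : Vec ℕ N) → nonzeros α ≡ 0 → vsum α ≡ 0
  vsum≤0 []         _ = ≡.refl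
  vsum≤0 (zero ∷ α) e = vsum≤0 α e

  δ-diag : ∀ n → δ n n ≡ ℤ.1ℤ
  δ-diag zero    = ≡.refl
  δ-diag (suc n) = δ-diag n

  δ-off : ∀ m n → ¬ (m ≡ n) → δ m n ≡ ℤ.0ℤ
  δ-off zero    zero    m≢n = contradiction ≡.refl m≢n
  δ-off zero    (suc n) m≢n = ≡.refl
  δ-off (suc m) zero    m≢n = ≡.refl
  δ-off (suc m) (suc n) m≢n = δ-off m n (m≢n ∘ cong suc)

  δ-≟ : ∀ m n → δ m n ≡ (if does (m ℕ.≟ n) then ℤ.1ℤ else ℤ.0ℤ)
  δ-≟ zero    zero    = ≡.refl
  δ-≟ zero    (suc n) = ≡.refl
  δ-≟ (suc m) zero    = ≡.refl
  δ-≟ (suc m) (suc n) = δ-≟ m n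

  -- Off the diagonal both sides vanish. This allows identities that are available only for
  -- exponents of the right total degree.
  δ-guard : ∀ m n {x y} → (m ≡ n → x ≡ y) → δ m n ℤ.* x ≡ δ m n ℤ.* y
  δ-guard m n x≡y with m ℕ.≟ n
  ... | yes m≡n = cong (λ z → δ m n ℤ.* z) (x≡y m≡n)
  ... | no  m≢n rewrite δ-off m n m≢n = ≡.refl

  pnrCoeff-δ : ∀ n r {N} (α : Vec ℕ N) → pnrCoeff n r α ≡ δ (vsum α) n ℤ.* δ (nonzeros α) r
  pnrCoeff-δ n r α rewrite δ-≟ (vsum α) n | δ-≟ (nonzeros α) r with does (vsum α ℕ.≟ n) | does (nonzeros α ℕ.≟ r)
  ... | true  | true  = ≡.refl
  ... | true  | false = ≡.refl
  ... | false | _     = ≡.refl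

  -- h_n = Σ_{k≥1} (-1)^(k-1) e_k h_{n-k}; the first argument bounds the recursion depth.
  completeE′ : ℕ → ℕ → EExpr
  completeE′ f       zero    = (ℤ.1ℤ , []) ∷ []
  completeE′ zero    (suc n) = []
  completeE′ (suc f) (suc n) = sumE (suc n) (λ k → mulE (sgn k) (suc k) (completeE′ f (n ∸ k)))

  completeE : ℕ → EExpr
  completeE n = completeE′ n n

  -- Read off as the coefficient of u^r t^n in E((u-1)t) H(t).
  powerE : ℕ → ℕ → EExpr
  powerE n r = sumE (suc n) (λ m → mulE (sgn (m ℕ.+ r) ℤ.* ι (m C r)) m (completeE (n ∸ m)))

  unit-δ : ∀ {N} (α : Vec ℕ N) → unit α ≡ δ (vsum α) 0
  unit-δ []          = ≡.refl
  unit-δ (zero ∷ α)  = unit-δ α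
  unit-δ (suc a ∷ α) = ≡.refl

  -- The expressions for h_n and p_n^(r) are both built from terms c e_k h_(n-k), so this reduces
  -- each to an identity in the number of nonzero exponents.
  coeffE-elemMul-complete : ∀ {N} c k E (α : Vec ℕ N) n → k ≤ n → (∀ (α : Vec ℕ N) → coeffE E α ≡ δ (vsum α) (n ∸ k)) →
    coeffE (mulE c k E) α ≡ δ (vsum α) n ℤ.* (c ℤ.* ι (nonzeros α C k))
  coeffE-elemMul-complete c k E α n k≤n E-complete = begin
    coeffE (mulE c k E) α
      ≡⟨ coeffE-mulE c k E α ⟩
    c ℤ.* elemMul k (coeffE E) α
      ≡⟨ cong (λ x → c ℤ.* x) (≡.trans (elemMul-cong k E-complete α) (elemMul-δ k 0 (n ∸ k) α)) ⟩
    c ℤ.* (δ (vsum α) (n ∸ k ℕ.+ k) ℤ.* ι (nonzeros α C k))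
      ≡⟨ cong (λ x → c ℤ.* (δ (vsum α) x ℤ.* ι (nonzeros α C k))) (ℕₚ.m∸n+n≡m k≤n) ⟩
    c ℤ.* (δ (vsum α) n ℤ.* ι (nonzeros α C k))
      ≡⟨ solve 3 (λ c d x → c :* (d :* x) := d :* (c :* x)) ≡.refl c (δ (vsum α) n) (ι (nonzeros α C k)) ⟩
    δ (vsum α) n ℤ.* (c ℤ.* ι (nonzeros α C k)) ∎

  -- With z nonzero exponents and total degree n+1, the coefficient is Σ (-1)^k C(z,k+1). It equals
  -- 1 because z > 0 and the full alternating sum over subsets of a nonempty set is zero.
  coeffE-complete′ : ∀ {N} f n → n ≤ f → (α : Vec ℕ N) → coeffE (completeE′ f n) α ≡ δ (vsum α) n
  coeffE-complete′ f       zero    _         α = ≡.trans (ℤₚ.+-identityʳ _) (≡.trans (ℤₚ.*-identityˡ _) (unit-δ α))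
  coeffE-complete′ (suc f) (suc n) (s≤s n≤f) α = begin
    coeffE (completeE′ (suc f) (suc n)) α
      ≡⟨ Lℤ.lin-sumE (λ μ → elemWord μ α) (suc n) (λ k → mulE (sgn k) (suc k) (completeE′ f (n ∸ k))) ⟩
    sum (suc n) (λ k → coeffE (mulE (sgn k) (suc k) (completeE′ f (n ∸ k))) α)
      ≡⟨ Sℤ.sum-cong (suc n) (λ k k<1+n → coeffE-elemMul-complete (sgn k) (suc k) (completeE′ f (n ∸ k)) α (suc n) k<1+n
           (coeffE-complete′ f (n ∸ k) (ℕₚ.≤-trans (ℕₚ.m∸n≤m n k) n≤f))) ⟩
    sum (suc n) (λ k → D ℤ.* (sgn k ℤ.* ι (z C suc k)))
      ≡⟨ Sℤ.sum-distribˡ (suc n) D (λ k → sgn k ℤ.* ι (z C suc k)) ⟨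
    D ℤ.* sum (suc n) (λ k → sgn k ℤ.* ι (z C suc k))
      ≡⟨ δ-guard (vsum α) (suc n) one ⟩
    D ℤ.* ℤ.1ℤ
      ≡⟨ ℤₚ.*-identityʳ D ⟩
    D ∎
    where
    D : ℤ
    D = δ (vsum α) (suc n)
    z : ℕ
    z = nonzeros α
    T : ℤ
    T = sum (suc n) (λ k → sgn k ℤ.* ι (z C suc k))
    one : vsum α ≡ suc n → T ≡ ℤ.1ℤ
    one v≡ = begin
      T                              ≡⟨ ℤₚ.+-identityˡ T ⟨
      (ℤ.1ℤ ℤ.+ Sℤ.s) ℤ.+ T          ≡⟨ solve 3 (λ o s t → (o :+ s) :+ t := o :+ (s :+ t)) ≡.refl ℤ.1ℤ Sℤ.s T ⟩
      ℤ.1ℤ ℤ.+ (Sℤ.s ℤ.+ T)          ≡⟨ cong (λ x → ℤ.1ℤ ℤ.+ x) (flip T (≡.trans (≡.sym alternating) (δ-off z 0 z≢0))) ⟩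
      ℤ.1ℤ ℤ.+ ℤ.0ℤ                  ≡⟨ ℤₚ.+-identityʳ ℤ.1ℤ ⟩
      ℤ.1ℤ                           ∎
      where
      z≢0 : ¬ (z ≡ 0)
      z≢0 z≡0 with () ← ≡.trans (≡.sym v≡) (vsum≤0 α z≡0)
      z≤ : z ≤ suc n
      z≤ = ≡.subst (z ≤_) v≡ (nonzeros≤vsum α)
      -- The leading 1 is the term m = 0 of `binomial-inversion` at r = 0.
      alternating : δ z 0 ≡ ℤ.1ℤ ℤ.+ Sℤ.s ℤ.* T
      alternating = ≡.trans (≡.sym (Sℤ.binomial-inversion (suc n) z 0 z≤))
        (cong (λ x → ℤ.1ℤ ℤ.+ x) (≡.trans
          (Sℤ.sum-cong (suc n) (λ k _ → ≡.trans
            (cong (λ x → x ℤ.* ι (z C suc k)) (≡.trans (ℤₚ.*-identityʳ (sgn (suc k ℕ.+ 0))) (cong (λ j → sgn (suc j)) (ℕₚ.+-identityʳ k))))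
            (ℤₚ.*-assoc Sℤ.s (sgn k) (ι (z C suc k)))))
          (≡.sym (Sℤ.sum-distribˡ (suc n) Sℤ.s (λ k → sgn k ℤ.* ι (z C suc k))))))
      flip : ∀ t → ℤ.1ℤ ℤ.+ Sℤ.s ℤ.* t ≡ ℤ.0ℤ → Sℤ.s ℤ.+ t ≡ ℤ.0ℤ
      flip t e = begin
        -- For integers `s * 1` and `s * s` compute to `s` and 1, so this line only has to rewrite
        -- `t`.
        Sℤ.s ℤ.+ t                        ≡⟨ cong (λ x → Sℤ.s ℤ.+ x) (ℤₚ.*-identityˡ t) ⟨
        Sℤ.s ℤ.* ℤ.1ℤ ℤ.+ (Sℤ.s ℤ.* Sℤ.s) ℤ.* t
          ≡⟨ solve 3 (λ s o t → s :* o :+ s :* s :* t := s :* (o :+ s :* t)) ≡.refl Sℤ.s ℤ.1ℤ t ⟩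
        Sℤ.s ℤ.* (ℤ.1ℤ ℤ.+ Sℤ.s ℤ.* t)   ≡⟨ cong (λ x → Sℤ.s ℤ.* x) e ⟩
        Sℤ.s ℤ.* ℤ.0ℤ                     ∎

  coeffE-complete : ∀ {N} n (α : Vec ℕ N) → coeffE (completeE n) α ≡ δ (vsum α) n
  coeffE-complete n = coeffE-complete′ n n ℕₚ.≤-refl

  -- In degree n the m-th term contributes (-1)^(m+r) C(m,r) C(z,m), where z counts the nonzero
  -- exponents, and `binomial-inversion` leaves z = r. Its bound z ≤ n comes from |α| = n, hence the
  -- guard.
  coeffE-power : ∀ {N} n r (α : Vec ℕ N) → coeffE (powerE n r) α ≡ δ (vsum α) n ℤ.* δ (nonzeros α) r
  coeffE-power n r α = begin
    coeffE (powerE n r) α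
      ≡⟨ Lℤ.lin-sumE (λ μ → elemWord μ α) (suc n) (λ m → mulE (sgn (m ℕ.+ r) ℤ.* ι (m C r)) m (completeE (n ∸ m))) ⟩
    sum (suc n) (λ m → coeffE (mulE (sgn (m ℕ.+ r) ℤ.* ι (m C r)) m (completeE (n ∸ m))) α)
      ≡⟨ Sℤ.sum-cong (suc n) (λ { m (s≤s m≤n) →
           coeffE-elemMul-complete (sgn (m ℕ.+ r) ℤ.* ι (m C r)) m (completeE (n ∸ m)) α n m≤n (coeffE-complete (n ∸ m)) }) ⟩
    sum (suc n) (λ m → δ (vsum α) n ℤ.* (sgn (m ℕ.+ r) ℤ.* ι (m C r) ℤ.* ι (nonzeros α C m)))
      ≡⟨ Sℤ.sum-distribˡ (suc n) (δ (vsum α) n) (λ m → sgn (m ℕ.+ r) ℤ.* ι (m C r) ℤ.* ι (nonzeros α C m)) ⟨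
    δ (vsum α) n ℤ.* sum (suc n) (λ m → sgn (m ℕ.+ r) ℤ.* ι (m C r) ℤ.* ι (nonzeros α C m))
      ≡⟨ δ-guard (vsum α) n (λ v≡n → Sℤ.binomial-inversion n (nonzeros α) r (≡.subst (nonzeros α ≤_) v≡n (nonzeros≤vsum α))) ⟩
    δ (vsum α) n ℤ.* δ (nonzeros α) r ∎

  powerE-represents : ∀ n r → Represents (powerE n r) n r
  powerE-represents n r N α = ≡.trans (mcoeff-evalE (powerE n r) α)
    (≡.trans (coeffE-power n r α) (≡.sym (pnrCoeff-δ n r α)))

  -- An exponent of positive degree has a nonzero entry. At r = 0 the expression is Σ (-1)^m e_m
  -- h_(n+1-m), so this is the relation that φ later carries into `P₀≈0`.
  coeffE-power-zero : ∀ {N} n (α : Vec ℕ N) → coeffE (powerE (suc n) 0) α ≡ ℤ.0ℤ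
  coeffE-power-zero n α = ≡.trans (coeffE-power (suc n) 0 α) (≡.trans
    (δ-guard (vsum α) (suc n) (λ v≡ → δ-off (nonzeros α) 0 (λ z≡0 → case v≡ z≡0)))
    (ℤₚ.*-zeroʳ (δ (vsum α) (suc n))))
    where
    case : vsum α ≡ suc n → ¬ (nonzeros α ≡ 0)
    case v≡ z≡0 with () ← ≡.trans (≡.sym v≡) (vsum≤0 α z≡0)

open Existence

-- Algebraic independence of the elementary symmetric functions.

module Independence where
  open ≡.≡-Reasoning

  -- Removal of the first column of the Young diagram of an unsorted word. The result has one entry
  -- for each positive part, so its length is the first part of the conjugate.
  shiftDown : List ℕ → List ℕ
  shiftDown []          = []
  shiftDown (zero ∷ μ)  = shiftDown μ
  shiftDown (suc k ∷ μ) = k ∷ shiftDown μ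

  -- The conjugate partition of μ, cut off after N parts: the exponent of the
  -- lexicographically leading monomial of e_μ in N variables.
  leading : ∀ N → List ℕ → Vec ℕ N
  leading zero    μ = []
  leading (suc N) μ = length (shiftDown μ) ∷ leading N (shiftDown μ)

  _⊏_ : ∀ {N} → Vec ℕ N → Vec ℕ N → Set
  _⊏_ = Lex-< _≡_ _<_

  -- With N at least the largest part, `leading N` cuts nothing off and e_μ is nonzero in N
  -- variables.
  Bounded : ℕ → List ℕ → Set
  Bounded N = All (_≤ N)

  shiftDown-bounded : ∀ {N μ} → Bounded (suc N) μ → Bounded N (shiftDown μ)
  shiftDown-bounded {μ = []}        []          = []
  shiftDown-bounded {μ = zero ∷ μ}  (_ ∷ b)     = shiftDown-bounded b
  shiftDown-bounded {μ = suc k ∷ μ} (s≤s k≤N ∷ b) = k≤N ∷ shiftDown-bounded b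

  -- Each factor e_k with k > 0 has degree at most 1 in the first variable, and e_0 has degree 0.
  elemWord-above : ∀ {N} μ d (α : Vec ℕ N) → length (shiftDown μ) < d → elemWord μ (d ∷ α) ≡ ℤ.0ℤ
  elemWord-above []          (suc d) α _         = ≡.refl
  elemWord-above (zero ∷ μ)  d       α l<d       = elemWord-above μ d α l<d
  elemWord-above (suc k ∷ μ) (suc d) α (s≤s l<d) = cong₂ ℤ._+_
    (elemMul-zero (suc k) (λ β → elemWord-above μ (suc d) β (ℕₚ.m≤n⇒m≤1+n l<d)) α)
    (elemMul-zero k (λ β → elemWord-above μ d β l<d) α)

  -- To reach the top power of the first variable x, every factor e_k with k > 0 must contribute x
  -- e_(k-1), which leaves the word `shiftDown μ` in the other variables.
  elemWord-top : ∀ {N} μ (α : Vec ℕ N) → elemWord μ (length (shiftDown μ) ∷ α) ≡ elemWord (shiftDown μ) α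
  elemWord-top []          α = ≡.refl
  elemWord-top (zero ∷ μ)  α = elemWord-top μ α
  elemWord-top (suc k ∷ μ) α = ≡.trans (cong₂ ℤ._+_
    (elemMul-zero (suc k) (λ β → elemWord-above μ _ β (ℕₚ.n<1+n _)) α)
    (elemMul-cong k (elemWord-top μ) α)) (ℤₚ.+-identityˡ _)

  elemWord-⊏ : ∀ {N} μ (κ : Vec ℕ N) → leading N μ ⊏ κ → elemWord μ κ ≡ ℤ.0ℤ
  elemWord-⊏ μ []      (base ())
  elemWord-⊏ μ (d ∷ κ) (this l<d _)        = elemWord-above μ d κ l<d
  elemWord-⊏ μ (d ∷ κ) (next ≡.refl lead⊏κ) = ≡.trans (elemWord-top μ κ) (elemWord-⊏ (shiftDown μ) κ lead⊏κ)

  elemWord-leading : ∀ {N} μ → Bounded N μ → elemWord μ (leading N μ) ≡ ℤ.1ℤ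
  elemWord-leading {zero}  []       _           = ≡.refl
  elemWord-leading {zero}  (zero ∷ μ) (_ ∷ b)   = elemWord-leading μ b
  elemWord-leading {suc N} μ        b           = ≡.trans (elemWord-top μ (leading N (shiftDown μ)))
    (elemWord-leading (shiftDown μ) (shiftDown-bounded b))

  length-shiftDown : ∀ μ → length (shiftDown μ) ≤ length μ
  length-shiftDown []          = z≤n
  length-shiftDown (zero ∷ μ)  = ℕₚ.m≤n⇒m≤1+n (length-shiftDown μ)
  length-shiftDown (suc k ∷ μ) = s≤s (length-shiftDown μ)

  -- Lowering the parts forgets only the order and the number of zeros, and the length restores that
  -- number.
  zeros-first : ∀ μ → μ ↭ replicate (length μ ∸ length (shiftDown μ)) 0 ++ map suc (shiftDown μ)
  zeros-first []          = Perm.refl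
  zeros-first (zero ∷ μ) rewrite ℕₚ.+-∸-assoc 1 (length-shiftDown μ) = Perm.prep 0 (zeros-first μ)
  zeros-first (suc k ∷ μ) = ↭-trans (Perm.prep (suc k) (zeros-first μ))
    (↭-sym (Permₚ.shift (suc k) (replicate (length μ ∸ length (shiftDown μ)) 0) (map suc (shiftDown μ))))

  -- The leading exponent lists the lengths of the successive columns, from which `zeros-first`
  -- rebuilds the diagram starting with the last column. Zeros of μ itself leave no trace in
  -- `leading`, so the comparison is between the shifted words.
  shiftDown-↭ : ∀ N {μ ν} → Bounded N μ → Bounded N ν → leading N μ ≡ leading N ν → shiftDown μ ↭ shiftDown ν
  shiftDown-↭ zero    {μ} {ν} bμ bν _ = ≡.subst₂ _↭_ (≡.sym (empty bμ)) (≡.sym (empty bν)) Perm.refl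
    where
    empty : ∀ {μ} → Bounded 0 μ → shiftDown μ ≡ []
    empty []        = ≡.refl
    empty (z≤n ∷ b) = empty b
  shiftDown-↭ (suc N) {μ} {ν} bμ bν eq = ↭-trans (zeros-first (shiftDown μ)) (↭-trans
    (≡.subst (λ n → replicate (length (shiftDown μ) ∸ length (shiftDown (shiftDown μ))) 0 ++ map suc (shiftDown (shiftDown μ)) ↭ replicate n 0 ++ map suc (shiftDown (shiftDown ν))) same
      (Permₚ.++⁺ˡ (replicate (length (shiftDown μ) ∸ length (shiftDown (shiftDown μ))) 0) (Permₚ.map⁺ suc rec)))
    (↭-sym (zeros-first (shiftDown ν))))
    where
    rec : shiftDown (shiftDown μ) ↭ shiftDown (shiftDown ν)
    rec = shiftDown-↭ N (shiftDown-bounded bμ) (shiftDown-bounded bν) (Vecₚ.∷-injectiveʳ eq)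
    same : length (shiftDown μ) ∸ length (shiftDown (shiftDown μ)) ≡ length (shiftDown ν) ∸ length (shiftDown (shiftDown ν))
    same = cong₂ _∸_ (Vecₚ.∷-injectiveˡ eq) (Permₚ.↭-length rec)

  -- f μ depends only on the product e_μ: neither the order of μ nor the factors e_0 = 1 matter.
  record Multiplicative {A : Set} (_∼_ : A → A → Set) (f : List ℕ → A) : Set where
    field
      ∼-refl  : ∀ {x} → x ∼ x
      ∼-sym   : ∀ {x y} → x ∼ y → y ∼ x
      ∼-trans : ∀ {x y z} → x ∼ y → y ∼ z → x ∼ z
      zero-∷  : ∀ μ → f (0 ∷ μ) ∼ f μ
      ∷-cong  : ∀ k {μ ν} → f μ ∼ f ν → f (k ∷ μ) ∼ f (k ∷ ν)
      swap    : ∀ k l μ → f (k ∷ l ∷ μ) ∼ f (l ∷ k ∷ μ)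

    ↭-invariant : ∀ {μ ν} → μ ↭ ν → f μ ∼ f ν
    ↭-invariant Perm.refl           = ∼-refl
    ↭-invariant (Perm.prep k μ↭ν)   = ∷-cong k (↭-invariant μ↭ν)
    ↭-invariant (Perm.swap k l μ↭ν) = ∼-trans (swap k l _) (∷-cong l (∷-cong k (↭-invariant μ↭ν)))
    ↭-invariant (Perm.trans p q)    = ∼-trans (↭-invariant p) (↭-invariant q)

    drop-zeros : ∀ μ → f μ ∼ f (map suc (shiftDown μ))
    drop-zeros []          = ∼-refl
    drop-zeros (zero ∷ μ)  = ∼-trans (zero-∷ μ) (drop-zeros μ)
    drop-zeros (suc k ∷ μ) = ∷-cong (suc k) (drop-zeros μ)

    leading-invariant : ∀ N {μ ν} → Bounded N μ → Bounded N ν → leading N μ ≡ leading N ν → f μ ∼ f ν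
    leading-invariant N {μ} {ν} bμ bν eq = ∼-trans (drop-zeros μ)
      (∼-trans (↭-invariant (Permₚ.map⁺ suc (shiftDown-↭ N bμ bν eq))) (∼-sym (drop-zeros ν)))

  elemWord-multiplicative : ∀ {N} → Multiplicative {Coeffs N} _≗_ elemWord
  elemWord-multiplicative = record
    { ∼-refl  = λ _ → ≡.refl
    ; ∼-sym   = λ p α → ≡.sym (p α)
    ; ∼-trans = λ p q α → ≡.trans (p α) (q α)
    ; zero-∷  = λ _ _ → ≡.refl
    ; ∷-cong  = λ k → elemMul-cong k
    ; swap    = λ k l μ → elemMul-comm k l (elemWord μ)
    }

  maximum : ∀ {N} (κ : Vec ℕ N) κs → ∃ λ m → m ∈ κ ∷ κs × All (λ x → x ≡ m ⊎ x ⊏ m) (κ ∷ κs)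
  maximum κ []        = κ , here ≡.refl , inj₁ ≡.refl ∷ []
  maximum κ (κ′ ∷ κs) with maximum κ′ κs
  ... | m , m∈ , below with Lex.<-cmp ≡.sym ℕₚ.<-cmp κ m
  ...   | tri< κ⊏m _ _ = m , there m∈ , inj₂ κ⊏m ∷ below
  ...   | tri≈ _ κ≋m _ = m , there m∈ , inj₁ (Pointwise-≡⇒≡ κ≋m) ∷ below
  ...   | tri> _ _ m⊏κ = κ , here ≡.refl , inj₁ ≡.refl ∷ All.map (inj₂ ∘ up) below
    where
    up : ∀ {x} → x ≡ m ⊎ x ⊏ m → x ⊏ κ
    up (inj₁ ≡.refl) = m⊏κ
    up (inj₂ x⊏m)    = Lex.<-trans (IsEquivalence.isPartialEquivalence ≡.isEquivalence) ℕₚ.<-resp₂-≡ ℕₚ.<-trans x⊏m m⊏κ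

  bound : EExpr → ℕ
  bound E = max 0 (map (max 0 ∘ proj₂) E)

  bound-bounded : ∀ E → All (λ t → Bounded (bound E) (proj₂ t)) E
  bound-bounded E = All.map (λ {t} le → All.map (λ k≤ → ℕₚ.≤-trans k≤ le) (xs≤max 0 (proj₂ t)))
    (Allₚ.map⁻ (xs≤max 0 (map (max 0 ∘ proj₂) E)))

  module Uniqueness (R : CommutativeRing 0ℓ 0ℓ) (scalars : Scalars R) where
    open CommutativeRing R hiding (zero)
    open Linear R scalars

    -- Independence in the form used: a relation among words in Λ already follows from commutativity
    -- and e_0 = 1, so it passes to every multiplicative `f`.
    lin-vanishes : ∀ {f} → Multiplicative _≈_ f → ∀ E → (∀ N (α : Vec ℕ N) → coeffE E α ≡ ℤ.0ℤ) → lin f E ≈ 0#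
    lin-vanishes {f} f-mult E E≡0 = go (length E) E ℕₚ.≤-refl (bound-bounded E) (E≡0 (bound E))
      where
      -- Fixed for the whole elimination; the shorter expressions met in `go` remain bounded by it.
      N : ℕ
      N = bound E

      lead : ℤ × List ℕ → Vec ℕ N
      lead = leading N ∘ proj₂

      -- The terms with the largest leading monomial contribute their total
      -- coefficient to that monomial; hence it is 0, and they can be dropped.
      go : ∀ n E → length E ≤ n → All (λ t → Bounded N (proj₂ t)) E →
        (∀ (α : Vec ℕ N) → coeffE E α ≡ ℤ.0ℤ) → lin f E ≈ 0#
      go n       []          _         _        _   = refl
      go (suc n) E@(t₀ ∷ ts) (s≤s |ts|≤n) bounded E≡0 with maximum (lead t₀) (map lead ts)
      ... | κ , κ∈ , below with ∈ₚ.∈-map⁻ lead {xs = E} κ∈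
      ...   | t , t∈ , ≡.refl = trans (lin-filter P? f E)
          (trans (+-cong (trans (lin-const (f (proj₂ t)) tops (tops-same f-mult)) (trans (*-congʳ (trans (reflexive (cong ρ total≡0)) ρ-0)) (zeroˡ _)))
                         (go n rest |rest|≤n (Allₚ.filter⁺ (¬? ∘ P?) bounded) rest≡0))
                 (+-identityˡ 0#))
        where
        P? : Decidable (λ s → lead s ≡ lead t)
        P? s = Vecₚ.≡-dec ℕ._≟_ (lead s) (lead t)
        tops rest : EExpr
        tops = filter P? E
        rest = filter (¬? ∘ P?) E

        |rest|≤n : length rest ≤ n
        |rest|≤n = ℕₚ.≤-trans (ℕ.s≤s⁻¹ (Listₚ.filter-notAll (¬? ∘ P?) E
          (Any.map (λ { ≡.refl ≢ → ≢ ≡.refl }) t∈))) |ts|≤n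

        -- Applied both to `f` and to `elemWord`: an equal leading exponent means the same product
        -- of e's.
        tops-same : ∀ {A : Set} {_∼_ : A → A → Set} {g} → Multiplicative _∼_ g → All (λ s → g (proj₂ s) ∼ g (proj₂ t)) tops
        tops-same g-mult = All.zipWith
          (λ { (lead≡ , b) → Multiplicative.leading-invariant g-mult N b (All.lookup bounded t∈) lead≡ })
          (Allₚ.all-filter P? E , Allₚ.filter⁺ P? bounded)

        coeffE-tops : ∀ (α : Vec ℕ N) → coeffE tops α ≡ total tops ℤ.* elemWord (proj₂ t) α
        coeffE-tops α = Lℤ.lin-const (elemWord (proj₂ t) α) tops (All.map (λ same → same α) (tops-same elemWord-multiplicative))

        rest-⊏ : All (λ s → lead s ⊏ lead t) rest
        rest-⊏ = All.zipWith (λ { (≢ , inj₁ ≡κ) → contradiction ≡κ ≢ ; (_ , inj₂ ⊏κ) → ⊏κ })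
          (Allₚ.all-filter (¬? ∘ P?) E , Allₚ.filter⁺ (¬? ∘ P?) (Allₚ.map⁻ below))

        total≡0 : total tops ≡ ℤ.0ℤ
        total≡0 = begin
          total tops                                        ≡⟨ ℤₚ.*-identityʳ (total tops) ⟨
          total tops ℤ.* ℤ.1ℤ                               ≡⟨ cong (λ x → total tops ℤ.* x) (elemWord-leading (proj₂ t) (All.lookup bounded t∈)) ⟨
          total tops ℤ.* elemWord (proj₂ t) (lead t)        ≡⟨ coeffE-tops (lead t) ⟨
          coeffE tops (lead t)                              ≡⟨ ℤₚ.+-identityʳ _ ⟨
          coeffE tops (lead t) ℤ.+ ℤ.0ℤ                     ≡⟨ cong (λ x → coeffE tops (lead t) ℤ.+ x)
                                                                 (Lℤ.lin-zero rest (All.map (λ {s} → elemWord-⊏ (proj₂ s) (lead t)) rest-⊏)) ⟨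
          coeffE tops (lead t) ℤ.+ coeffE rest (lead t)     ≡⟨ Lℤ.lin-filter P? (λ μ → elemWord μ (lead t)) E ⟨
          coeffE E (lead t)                                 ≡⟨ E≡0 (lead t) ⟩
          ℤ.0ℤ                                              ∎

        rest≡0 : ∀ (α : Vec ℕ N) → coeffE rest α ≡ ℤ.0ℤ
        rest≡0 α = begin
          coeffE rest α                            ≡⟨ ℤₚ.+-identityˡ _ ⟨
          ℤ.0ℤ ℤ.+ coeffE rest α                   ≡⟨ cong (λ x → x ℤ.* elemWord (proj₂ t) α ℤ.+ coeffE rest α) total≡0 ⟨
          total tops ℤ.* elemWord (proj₂ t) α ℤ.+ coeffE rest α ≡⟨ cong (λ x → x ℤ.+ coeffE rest α) (coeffE-tops α) ⟨
          coeffE tops α ℤ.+ coeffE rest α          ≡⟨ Lℤ.lin-filter P? (λ μ → elemWord μ α) E ⟨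
          coeffE E α                               ≡⟨ E≡0 α ⟩
          ℤ.0ℤ                                     ∎

    lin-unique : ∀ {f} → Multiplicative _≈_ f → ∀ E F →
      (∀ N (α : Vec ℕ N) → mcoeff (evalE N E) α ≡ mcoeff (evalE N F) α) → lin f E ≈ lin f F
    lin-unique {f} f-mult E F E≡F = x-y≈0⇒x≈y (trans (sym (trans (lin-++ f E (neg F)) (+-congˡ (lin-neg f F))))
      (lin-vanishes f-mult (E ++ neg F) (λ N α → begin
        coeffE (E ++ neg F) α             ≡⟨ ≡.trans (Lℤ.lin-++ _ E (neg F)) (cong (λ x → coeffE E α ℤ.+ x) (Lℤ.lin-neg _ F)) ⟩
        coeffE E α ℤ.- coeffE F α         ≡⟨ cong (λ x → x ℤ.- coeffE F α) (≡.trans (≡.sym (mcoeff-evalE E α)) (≡.trans (E≡F N α) (mcoeff-evalE F α))) ⟩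
        coeffE F α ℤ.- coeffE F α         ≡⟨ ℤₚ.+-inverseʳ (coeffE F α) ⟩
        ℤ.0ℤ                              ∎)))
      where
      x-y≈0⇒x≈y : ∀ {x y} → x - y ≈ 0# → x ≈ y
      x-y≈0⇒x≈y {x} {y} e = trans (sym (+-identityʳ x)) (trans (+-congˡ (sym (-‿inverseˡ y)))
        (trans (sym (+-assoc x (- y) y)) (trans (+-congʳ e) (+-identityˡ y))))

open Independence

-- The polynomials J: recurrence, degree and constant term.

-- The first argument of J′ bounds the recursion depth; m stands for n - r.
J′ : ℕ → ℕ → ℕ → List ℕ
J′ b       zero    r = ℕP.one
J′ zero    (suc m) r = []
J′ (suc b) (suc m) r = sumℕP (suc m) (λ j →
  ℕP.mul (ℕP.pow (qint r) j) (ℕP.mul (ℕP.mono (suc m C j) (j C 2)) (J′ b (suc m ∸ j) j)))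

J : ℕ → ℕ → List ℕ
J n r = J′ (n ∸ r) (n ∸ r) r

sumℕP-cong : ∀ m {f g} → (∀ i → i < m → f (suc i) ≡ g (suc i)) → sumℕP m f ≡ sumℕP m g
sumℕP-cong zero    f≡g = ≡.refl
sumℕP-cong (suc m) f≡g = cong₂ ℕP.add (sumℕP-cong m (λ i i<m → f≡g i (ℕₚ.m≤n⇒m≤1+n i<m))) (f≡g m ℕₚ.≤-refl)

J′-depth : ∀ b b′ m r → m ≤ b → m ≤ b′ → J′ b m r ≡ J′ b′ m r
J′-depth b       b′       zero    r _         _          = ≡.refl
J′-depth (suc b) (suc b′) (suc m) r (s≤s m≤b) (s≤s m≤b′) = sumℕP-cong (suc m) (λ i _ →
  cong (λ p → ℕP.mul (ℕP.pow (qint r) (suc i)) (ℕP.mul (ℕP.mono (suc m C suc i) (suc i C 2)) p))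
    (J′-depth b b′ (m ∸ i) (suc i) (ℕₚ.≤-trans (ℕₚ.m∸n≤m m i) m≤b) (ℕₚ.≤-trans (ℕₚ.m∸n≤m m i) m≤b′)))

J-recurrence : ∀ n r → 1 ≤ r → r ≤ n ∸ 1 →
  J n r ≡ sumℕP (n ∸ r) (λ j →
    ℕP.mul (ℕP.pow (qint r) j) (ℕP.mul (ℕP.mono ((n ∸ r) C j) (j C 2)) (J (n ∸ r) j)))
J-recurrence (suc n) (suc s) _ r≤n = ≡.subst
  (λ m → J′ m m (suc s) ≡ sumℕP m (λ j → ℕP.mul (ℕP.pow (qint (suc s)) j) (ℕP.mul (ℕP.mono (m C j) (j C 2)) (J m j))))
  (≡.sym (ℕₚ.+-∸-assoc 1 r≤n))
  (sumℕP-cong (suc (n ∸ suc s)) (λ i _ →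
    cong (λ p → ℕP.mul (ℕP.pow (qint (suc s)) (suc i)) (ℕP.mul (ℕP.mono (suc (n ∸ suc s) C suc i) (suc i C 2)) p))
      (J′-depth (n ∸ suc s) _ ((n ∸ suc s) ∸ i) (suc i) (ℕₚ.m∸n≤m (n ∸ suc s) i) ℕₚ.≤-refl)))

VanishesAbove : List ℕ → ℕ → Set
VanishesAbove p d = ∀ k → d < k → ℕP.coeff p k ≡ 0

mul-top : ∀ p q {d e x y} → ℕP.coeff p d ≡ x × VanishesAbove p d → ℕP.coeff q e ≡ y × VanishesAbove q e →
  ℕP.coeff (ℕP.mul p q) (d ℕ.+ e) ≡ x ℕ.* y × VanishesAbove (ℕP.mul p q) (d ℕ.+ e)
mul-top p q {d} {e} (pd , p≡0) (qe , q≡0) with ℕConv.conv-top d e p≡0 q≡0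
... | top , above = ≡.trans (ℕConv.coeff-mul p q (d ℕ.+ e)) (≡.trans top (cong₂ ℕ._*_ pd qe))
                  , λ k d+e<k → ≡.trans (ℕConv.coeff-mul p q k) (above k d+e<k)

mono-top : ∀ c d → ℕP.coeff (ℕP.mono c d) d ≡ c × VanishesAbove (ℕP.mono c d) d
mono-top c zero    = ≡.refl , λ { (suc k) _ → ≡.refl }
mono-top c (suc d) = proj₁ (mono-top c d) , λ { (suc k) (s≤s d<k) → proj₂ (mono-top c d) k d<k }

qint-top : ∀ s → ℕP.MonicOfDegree (qint (suc s)) s
qint-top zero    = ≡.refl , λ { (suc k) _ → ≡.refl }
qint-top (suc s) = proj₁ (qint-top s) , λ { (suc k) (s≤s s<k) → proj₂ (qint-top s) k s<k }

pow-top : ∀ p d → ℕP.MonicOfDegree p d → ∀ j → ℕP.MonicOfDegree (ℕP.pow p j) (j ℕ.* d)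
pow-top p d monic zero    = mono-top 1 0
pow-top p d monic (suc j) = mul-top p (ℕP.pow p j) monic (pow-top p d monic j)

sumℕP-vanishes : ∀ m f k → (∀ i → i < m → ℕP.coeff (f (suc i)) k ≡ 0) → ℕP.coeff (sumℕP m f) k ≡ 0
sumℕP-vanishes zero    f k f≡0 = ≡.refl
sumℕP-vanishes (suc m) f k f≡0 = ≡.trans (ℕConv.coeff-add (sumℕP m f) (f (suc m)) k)
  (cong₂ ℕ._+_ (sumℕP-vanishes m f k (λ i i<m → f≡0 i (ℕₚ.m≤n⇒m≤1+n i<m))) (f≡0 m ℕₚ.≤-refl))

sumℕP-last : ∀ m f k → (∀ i → i < m → ℕP.coeff (f (suc i)) k ≡ 0) →
  ℕP.coeff (sumℕP (suc m) f) k ≡ ℕP.coeff (f (suc m)) k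
sumℕP-last m f k f≡0 = ≡.trans (ℕConv.coeff-add (sumℕP m f) (f (suc m)) k)
  (cong (ℕ._+ ℕP.coeff (f (suc m)) k) (sumℕP-vanishes m f k f≡0))

sumℕP-first : ∀ m f k → (∀ i → ℕP.coeff (f (suc (suc i))) k ≡ 0) →
  ℕP.coeff (sumℕP (suc m) f) k ≡ ℕP.coeff (f 1) k
sumℕP-first zero    f k f≡0 = ≡.refl
sumℕP-first (suc m) f k f≡0 = ≡.trans (ℕConv.coeff-add (sumℕP (suc m) f) (f (suc (suc m))) k)
  (≡.trans (cong₂ ℕ._+_ (sumℕP-first m f k f≡0) (f≡0 m)) (ℕₚ.+-identityʳ _))

-- With r = s + 1, the summand j = i + 1 falls short of degree d by (m-i)(s+1), which is the amount
-- added in `gap`. Only the last summand reaches d, and its leading coefficient is C(M,M) = 1.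
J′-monic : ∀ b m s → m ≤ b → ℕP.MonicOfDegree (J′ b m (suc s)) (m ℕ.* s ℕ.+ m C 2)
J′-monic b       zero    s _         = mono-top 1 0
J′-monic (suc b) (suc m) s (s≤s m≤b) =
    ≡.trans (sumℕP-last m term d (λ i i<m → proj₂ (term-top i (ℕₚ.<⇒≤ i<m)) d (small i i<m)))
      (≡.trans (cong (ℕP.coeff (term M)) d≡) (≡.trans (proj₁ (term-top m ℕₚ.≤-refl))
        (≡.trans (ℕₚ.*-identityˡ _) (≡.trans (ℕₚ.*-identityʳ _) (nCn≡1 M)))))
  , λ k d<k → sumℕP-vanishes M term k λ { i (s≤s i≤m) → proj₂ (term-top i i≤m) k (ℕₚ.≤-trans (s≤s (bound≤ i i≤m)) d<k) }
  where
  M d : ℕ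
  M = suc m
  d = M ℕ.* s ℕ.+ M C 2
  term : ℕ → List ℕ
  term j = ℕP.mul (ℕP.pow (qint (suc s)) j) (ℕP.mul (ℕP.mono (M C j) (j C 2)) (J′ b (M ∸ j) j))
  -- The degrees of [r]^j, of q^C(j,2), and of J_M^(j) by induction, at j = i + 1.
  deg : ℕ → ℕ
  deg i = suc i ℕ.* s ℕ.+ (suc i C 2 ℕ.+ ((m ∸ i) ℕ.* i ℕ.+ (m ∸ i) C 2))
  term-top : ∀ i → i ≤ m → ℕP.coeff (term (suc i)) (deg i) ≡ 1 ℕ.* ((M C suc i) ℕ.* 1) × VanishesAbove (term (suc i)) (deg i)
  term-top i i≤m = mul-top (ℕP.pow (qint (suc s)) (suc i)) _ (pow-top (qint (suc s)) s (qint-top s) (suc i))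
    (mul-top (ℕP.mono (M C suc i) (suc i C 2)) (J′ b (m ∸ i) (suc i)) (mono-top (M C suc i) (suc i C 2))
      (J′-monic b (m ∸ i) i (ℕₚ.≤-trans (ℕₚ.m∸n≤m m i) m≤b)))
  gap : ∀ i → i ≤ m → deg i ℕ.+ ((m ∸ i) ℕ.* s ℕ.+ (m ∸ i)) ≡ d
  gap i i≤m = ≡.trans (split i (m ∸ i)) (cong (λ n → n ℕ.* s ℕ.+ n C 2) (cong suc (ℕₚ.m+[n∸m]≡n i≤m)))
    where
    open NaturalCoefficients ℕₚ.+-*-commutativeSemiring using (solve; _:+_; _:*_; _:=_; con)
    split : ∀ i k → suc i ℕ.* s ℕ.+ (suc i C 2 ℕ.+ (k ℕ.* i ℕ.+ k C 2)) ℕ.+ (k ℕ.* s ℕ.+ k) ≡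
      (suc i ℕ.+ k) ℕ.* s ℕ.+ (suc i ℕ.+ k) C 2
    split i k = ≡.trans
      (solve 5 (λ i k s x y → (con 1 :+ i) :* s :+ (x :+ (k :* i :+ y)) :+ (k :* s :+ k) :=
        ((con 1 :+ i) :+ k) :* s :+ (x :+ (y :+ (con 1 :+ i) :* k))) ≡.refl i k s (suc i C 2) (k C 2))
      (cong ((suc i ℕ.+ k) ℕ.* s ℕ.+_) (≡.sym (+-C2 (suc i) k)))
  bound≤ : ∀ i → i ≤ m → deg i ≤ d
  bound≤ i i≤m = ≡.subst (deg i ≤_) (gap i i≤m) (ℕₚ.m≤m+n (deg i) _)
  small : ∀ i → i < m → deg i < d
  small i i<m = ≡.subst (deg i <_) (gap i (ℕₚ.<⇒≤ i<m)) (ℕₚ.m<m+n (deg i)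
    (ℕₚ.≤-trans (ℕₚ.m<n⇒0<n∸m i<m) (ℕₚ.m≤n+m (m ∸ i) ((m ∸ i) ℕ.* s))))
  d≡ : d ≡ deg m
  d≡ = ≡.trans (≡.sym (gap m ℕₚ.≤-refl)) (≡.trans (cong (λ k → deg m ℕ.+ (k ℕ.* s ℕ.+ k)) (ℕₚ.n∸n≡0 m)) (ℕₚ.+-identityʳ (deg m)))

-- At q = 0 the factor q^C(j,2) leaves only j = 1, and [r] becomes 1; the remaining value is (m+1)
-- m!.
J′-constant : ∀ b m s → m ≤ b → ℕP.coeff (J′ b m (suc s)) 0 ≡ m !
J′-constant b       zero    s _         = ≡.refl
J′-constant (suc b) (suc m) s (s≤s m≤b) = begin
  ℕP.coeff (sumℕP (suc m) term) 0
    ≡⟨ sumℕP-first m term 0 higher ⟩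
  ℕP.coeff (term 1) 0
    ≡⟨ at-0 1 ⟩
  1 ℕ.* ((suc m C 1) ℕ.* ℕP.coeff (J′ b m 1) 0)
    ≡⟨ ℕₚ.*-identityˡ _ ⟩
  (suc m C 1) ℕ.* ℕP.coeff (J′ b m 1) 0
    ≡⟨ cong₂ ℕ._*_ (nC1≡n (suc m)) (J′-constant b m 0 m≤b) ⟩
  suc m ! ∎
  where
  open ≡.≡-Reasoning
  term : ℕ → List ℕ
  term j = ℕP.mul (ℕP.pow (qint (suc s)) j) (ℕP.mul (ℕP.mono (suc m C j) (j C 2)) (J′ b (suc m ∸ j) j))
  pow-at-0 : ∀ j → ℕP.coeff (ℕP.pow (qint (suc s)) j) 0 ≡ 1
  pow-at-0 zero    = ≡.refl
  pow-at-0 (suc j) = ≡.trans (ℕConv.coeff-mul (qint (suc s)) (ℕP.pow (qint (suc s)) j) 0)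
    (≡.trans (ℕₚ.*-identityˡ _) (pow-at-0 j))
  at-0 : ∀ j → ℕP.coeff (term j) 0 ≡ 1 ℕ.* (ℕP.coeff (ℕP.mono (suc m C j) (j C 2)) 0 ℕ.* ℕP.coeff (J′ b (suc m ∸ j) j) 0)
  at-0 j = ≡.trans (ℕConv.coeff-mul (ℕP.pow (qint (suc s)) j) _ 0)
    (cong₂ ℕ._*_ (pow-at-0 j) (ℕConv.coeff-mul (ℕP.mono (suc m C j) (j C 2)) _ 0))
  higher : ∀ i → ℕP.coeff (term (suc (suc i))) 0 ≡ 0
  higher i = ≡.trans (at-0 (suc (suc i))) (≡.trans (ℕₚ.*-identityˡ _)
    -- Here `suc-C2` exhibits C(j,2) as a successor for j > 1, so the monomial has constant term 0
    -- by computation.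
    (cong (λ e → ℕP.coeff (ℕP.mono (suc m C suc (suc i)) e) 0 ℕ.* ℕP.coeff (J′ b (m ∸ suc i) (suc (suc i))) 0) (suc-C2 (suc i))))

-- Integers inside ℚ.

open import Data.Integer using (+_)

-- Identities between normalised fractions are checked on unnormalised ones, where c/1 has an
-- explicit numerator and denominator.
toℚᵘ-/1 : ∀ c → ℚ.toℚᵘ (c / 1) ℚᵘ.≃ ℚᵘ.mkℚᵘ c 0
toℚᵘ-/1 c = ℚₚ.toℚᵘ-fromℚᵘ (ℚᵘ.mkℚᵘ c 0)

/1-+ : ∀ c d → (c ℤ.+ d) / 1 ≡ (c / 1) ℚ.+ (d / 1)
/1-+ c d = ℚₚ.toℚᵘ-injective (begin
  ℚ.toℚᵘ ((c ℤ.+ d) / 1)                       ≈⟨ toℚᵘ-/1 (c ℤ.+ d) ⟩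
  ℚᵘ.mkℚᵘ (c ℤ.+ d) 0                          ≈⟨ ℚᵘ.*≡* (cong (ℤ._* + 1) (cong₂ ℤ._+_ (≡.sym (ℤₚ.*-identityʳ c)) (≡.sym (ℤₚ.*-identityʳ d)))) ⟩
  ℚᵘ.mkℚᵘ c 0 ℚᵘ.+ ℚᵘ.mkℚᵘ d 0                 ≈⟨ ℚᵘₚ.+-cong (toℚᵘ-/1 c) (toℚᵘ-/1 d) ⟨
  ℚ.toℚᵘ (c / 1) ℚᵘ.+ ℚ.toℚᵘ (d / 1)           ≈⟨ ℚₚ.toℚᵘ-homo-+ (c / 1) (d / 1) ⟨
  ℚ.toℚᵘ ((c / 1) ℚ.+ (d / 1))                 ∎)
  where open ℚᵘₚ.≃-Reasoning

/1-* : ∀ c d → (c ℤ.* d) / 1 ≡ (c / 1) ℚ.* (d / 1)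
/1-* c d = ℚₚ.toℚᵘ-injective (begin
  ℚ.toℚᵘ ((c ℤ.* d) / 1)                       ≈⟨ toℚᵘ-/1 (c ℤ.* d) ⟩
  ℚᵘ.mkℚᵘ c 0 ℚᵘ.* ℚᵘ.mkℚᵘ d 0                 ≈⟨ ℚᵘₚ.*-cong (toℚᵘ-/1 c) (toℚᵘ-/1 d) ⟨
  ℚ.toℚᵘ (c / 1) ℚᵘ.* ℚ.toℚᵘ (d / 1)           ≈⟨ ℚₚ.toℚᵘ-homo-* (c / 1) (d / 1) ⟨
  ℚ.toℚᵘ ((c / 1) ℚ.* (d / 1))                 ∎)
  where open ℚᵘₚ.≃-Reasoning

/1-inverse : ∀ n .{{_ : ℕ.NonZero n}} → (+ n / 1) ℚ.* (+ 1 / n) ≡ ℚ.1ℚ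
/1-inverse (suc n) = ℚₚ.toℚᵘ-injective (begin
  ℚ.toℚᵘ ((+ suc n / 1) ℚ.* (+ 1 / suc n))              ≈⟨ ℚₚ.toℚᵘ-homo-* (+ suc n / 1) (+ 1 / suc n) ⟩
  ℚ.toℚᵘ (+ suc n / 1) ℚᵘ.* ℚ.toℚᵘ (+ 1 / suc n)        ≈⟨ ℚᵘₚ.*-cong (toℚᵘ-/1 (+ suc n)) (ℚₚ.toℚᵘ-fromℚᵘ (ℚᵘ.mkℚᵘ (+ 1) n)) ⟩
  ℚᵘ.mkℚᵘ (+ suc n) 0 ℚᵘ.* ℚᵘ.mkℚᵘ (+ 1) n              ≈⟨ ℚᵘ.*≡* (≡.trans (ℤₚ.*-identityʳ _) (≡.trans (ℤₚ.*-identityʳ _)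
                                                             (≡.sym (≡.trans (ℤₚ.*-identityˡ _) (cong +_ (ℕₚ.+-identityʳ (suc n))))))) ⟩
  ℚ.toℚᵘ ℚ.1ℚ                                           ∎)
  where open ℚᵘₚ.≃-Reasoning

-- The specialisation φ with values in ℚ[[q]].

module 𝕊 = CommutativeRing series
module Σ𝕊 = Sums series
open ℚConv using (const; shift; conv; conv-constˡ; conv-shiftˡ; coeff-mul; coeff-one; coeff-add; coeff-scale)
open Σ𝕊 using (pow; ι; sgn; sum)

scalars : Scalars series
scalars = record
  { ρ   = λ c → const (c / 1)
  ; ρ-+ = λ { c d zero → /1-+ c d ; c d (suc k) → ≡.sym (ℚₚ.+-identityˡ ℚ.0ℚ) }
  ; ρ-* = λ c d k → ≡.trans (product c d k) (≡.sym (conv-constˡ (c / 1) (const (d / 1)) k))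
  ; ρ-1 = λ _ → ≡.refl
  }
  where
  product : ∀ c d k → const ((c ℤ.* d) / 1) k ≡ (c / 1) ℚ.* const (d / 1) k
  product c d zero    = /1-* c d
  product c d (suc k) = ≡.sym (ℚₚ.*-zeroʳ (c / 1))

module L𝕊 = Linear series scalars
open L𝕊 using (lin)

ιℤ≡+ : ∀ n → Sℤ.ι n ≡ + n
ιℤ≡+ zero    = ≡.refl
ιℤ≡+ (suc n) = cong (λ x → ℤ.1ℤ ℤ.+ x) (ιℤ≡+ n)

ι-const : ∀ n → ι n 𝕊.≈ const (+ n / 1)
ι-const n = 𝕊.trans (𝕊.sym (L𝕊.ρ-ι n)) (𝕊.reflexive (cong (λ c → const (c / 1)) (ιℤ≡+ n)))

X : ℕ → ℚ
X = shift (const ℚ.1ℚ)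

X-* : ∀ f → X 𝕊.* f 𝕊.≈ shift f
X-* f k = ≡.trans (conv-shiftˡ (const ℚ.1ℚ) f k) (shift-cong (𝕊.*-identityˡ f) k)
  where
  shift-cong : ∀ {f g} → f ≗ g → shift f ≗ shift g
  shift-cong f≗g zero    = ≡.refl
  shift-cong f≗g (suc k) = f≗g k

coeff-∷ : ∀ a p → ℚP.coeff (a ∷ p) 𝕊.≈ (const a 𝕊.+ X 𝕊.* ℚP.coeff p)
coeff-∷ a p k = ≡.trans (split k) (cong (const a k ℚ.+_) (≡.sym (X-* (ℚP.coeff p) k)))
  where
  split : ∀ k → ℚP.coeff (a ∷ p) k ≡ const a k ℚ.+ shift (ℚP.coeff p) k
  split zero    = ≡.sym (ℚₚ.+-identityʳ a)
  split (suc k) = ≡.sym (ℚₚ.+-identityˡ (ℚP.coeff p k))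

coeff-mono : ∀ c d → ℚP.coeff (ℚP.mono c d) 𝕊.≈ (const c 𝕊.* pow X d)
coeff-mono c zero    = 𝕊.trans (𝕊.trans (coeff-∷ c []) (𝕊.trans (𝕊.+-congˡ {const c} (𝕊.zeroʳ X)) (𝕊.+-identityʳ (const c))))
  (𝕊.sym (𝕊.*-identityʳ (const c)))
coeff-mono c (suc d) = begin
  ℚP.coeff (ℚ.0ℚ ∷ ℚP.mono c d)               ≈⟨ coeff-∷ ℚ.0ℚ (ℚP.mono c d) ⟩
  const ℚ.0ℚ 𝕊.+ X 𝕊.* ℚP.coeff (ℚP.mono c d)  ≈⟨ 𝕊.+-cong {const ℚ.0ℚ} {𝕊.0#} (λ { zero → ≡.refl ; (suc k) → ≡.refl }) (𝕊.*-congˡ {X} (coeff-mono c d)) ⟩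
  𝕊.0# 𝕊.+ X 𝕊.* (const c 𝕊.* pow X d)         ≈⟨ 𝕊.+-identityˡ _ ⟩
  X 𝕊.* (const c 𝕊.* pow X d)                 ≈⟨ x∙yz≈y∙xz X (const c) (pow X d) ⟩
  const c 𝕊.* (X 𝕊.* pow X d)                 ∎
  where
  open SetoidReasoning 𝕊.setoid
  open CommutativeSemigroupProperties 𝕊.*-commutativeSemigroup

φ-word : List ℕ → ℕ → ℚ
φ-word μ = ℚP.coeff (φμ μ)

coeff-φ : ∀ E → ℚP.coeff (φ E) 𝕊.≈ lin φ-word E
coeff-φ []            k = ≡.refl
coeff-φ ((c , μ) ∷ E) k = ≡.trans (coeff-add (ℚP.scale (c / 1) (φμ μ)) (φ E) k)
  (cong₂ ℚ._+_ (≡.trans (coeff-scale (c / 1) (φμ μ) k) (≡.sym (conv-constˡ (c / 1) (φ-word μ) k))) (coeff-φ E k))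

φ-word-∷ : ∀ k μ → φ-word (k ∷ μ) 𝕊.≈ (ℚP.coeff (φe k) 𝕊.* φ-word μ)
φ-word-∷ k μ = coeff-mul (φe k) (φμ μ)

φ-word-multiplicative : Multiplicative 𝕊._≈_ φ-word
φ-word-multiplicative = record
  { ∼-refl  = 𝕊.refl
  ; ∼-sym   = 𝕊.sym
  ; ∼-trans = 𝕊.trans
  -- `φe 0` computes to the polynomial 1, in agreement with e_0 = 1.
  ; zero-∷  = λ μ → 𝕊.trans (φ-word-∷ 0 μ) (𝕊.trans (𝕊.*-congʳ {φ-word μ} coeff-one) (𝕊.*-identityˡ (φ-word μ)))
  ; ∷-cong  = λ k {μ} {ν} eq → 𝕊.trans (φ-word-∷ k μ) (𝕊.trans (𝕊.*-congˡ {ℚP.coeff (φe k)} eq) (𝕊.sym (φ-word-∷ k ν)))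
  ; swap    = λ k l μ → 𝕊.trans (two k l μ) (𝕊.trans
      (x∙yz≈y∙xz (ℚP.coeff (φe k)) (ℚP.coeff (φe l)) (φ-word μ)) (𝕊.sym (two l k μ)))
  }
  where
  open CommutativeSemigroupProperties 𝕊.*-commutativeSemigroup
  two : ∀ k l μ → φ-word (k ∷ l ∷ μ) 𝕊.≈ (ℚP.coeff (φe k) 𝕊.* (ℚP.coeff (φe l) 𝕊.* φ-word μ))
  two k l μ = 𝕊.trans (φ-word-∷ k (l ∷ μ)) (𝕊.*-congˡ {ℚP.coeff (φe k)} (φ-word-∷ l μ))

coeffℚ : List ℕ → ℕ → ℚ
coeffℚ p k = (+ ℕP.coeff p k) / 1

coeff-toℚ : ∀ p → ℚP.coeff (toℚ p) 𝕊.≈ coeffℚ p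
coeff-toℚ []      k       = ≡.refl
coeff-toℚ (a ∷ p) zero    = ≡.refl
coeff-toℚ (a ∷ p) (suc k) = coeff-toℚ p k

+/1-* : ∀ m n → (+ (m ℕ.* n)) / 1 ≡ (+ m / 1) ℚ.* (+ n / 1)
+/1-* m n = ≡.trans (cong (_/ 1) (ℤₚ.pos-* m n)) (/1-* (+ m) (+ n))

coeffℚ-add : ∀ p q → coeffℚ (ℕP.add p q) 𝕊.≈ (coeffℚ p 𝕊.+ coeffℚ q)
coeffℚ-add p q k = ≡.trans (cong (λ n → + n / 1) (ℕConv.coeff-add p q k)) (/1-+ (+ ℕP.coeff p k) (+ ℕP.coeff q k))

coeffℚ-mul : ∀ p q → coeffℚ (ℕP.mul p q) 𝕊.≈ (coeffℚ p 𝕊.* coeffℚ q)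
coeffℚ-mul p q k = ≡.trans (cong (λ n → + n / 1) (ℕConv.coeff-mul p q k)) (go (ℕP.coeff p) (ℕP.coeff q) k)
  where
  go : ∀ f g k → + ℕConv.conv f g k / 1 ≡ conv (λ i → + f i / 1) (λ i → + g i / 1) k
  go f g zero    = +/1-* (f 0) (g 0)
  go f g (suc k) = ≡.trans (/1-+ (+ (f 0 ℕ.* g (suc k))) (+ ℕConv.conv (f ∘ suc) g k))
    (cong₂ ℚ._+_ (+/1-* (f 0) (g (suc k))) (go (f ∘ suc) g k))

coeffℚ-one : coeffℚ ℕP.one 𝕊.≈ 𝕊.1#
coeffℚ-one zero    = ≡.refl
coeffℚ-one (suc k) = ≡.refl

coeffℚ-pow : ∀ p n → coeffℚ (ℕP.pow p n) 𝕊.≈ pow (coeffℚ p) n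
coeffℚ-pow p zero    = coeffℚ-one
coeffℚ-pow p (suc n) = 𝕊.trans (coeffℚ-mul p (ℕP.pow p n)) (𝕊.*-congˡ {coeffℚ p} (coeffℚ-pow p n))

coeffℚ-mono : ∀ c d → coeffℚ (ℕP.mono c d) 𝕊.≈ (ι c 𝕊.* pow X d)
coeffℚ-mono c d = 𝕊.trans (same d) (𝕊.trans (coeff-mono (+ c / 1) d) (𝕊.*-congʳ {pow X d} (𝕊.sym (ι-const c))))
  where
  same : ∀ d → coeffℚ (ℕP.mono c d) 𝕊.≈ ℚP.coeff (ℚP.mono (+ c / 1) d)
  same zero    zero    = ≡.refl
  same zero    (suc k) = ≡.refl
  same (suc d) zero    = ≡.refl
  same (suc d) (suc k) = same d k

coeffℚ-sum : ∀ m f → coeffℚ (sumℕP m f) 𝕊.≈ sum m (λ i → coeffℚ (f (suc i)))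
coeffℚ-sum zero    f = λ _ → ≡.refl
coeffℚ-sum (suc m) f = 𝕊.trans (coeffℚ-add (sumℕP m f) (f (suc m)))
  (𝕊.trans (𝕊.+-congʳ {coeffℚ (f (suc m))} (coeffℚ-sum m f)) (𝕊.sym (Σ𝕊.sum-last m (λ i → coeffℚ (f (suc i))))))

1-X : ℕ → ℚ
1-X = 𝕊.1# 𝕊.+ Σ𝕊.s 𝕊.* X

-- Induction on the Horner form [r+1] = 1 + q [r], which is how `qint` is built.
coeffℚ-qint : ∀ r → (1-X 𝕊.* coeffℚ (qint r)) 𝕊.≈ (𝕊.1# 𝕊.+ Σ𝕊.s 𝕊.* pow X r)
coeffℚ-qint zero = begin
  1-X 𝕊.* 𝕊.0#              ≈⟨ 𝕊.zeroʳ 1-X ⟩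
  𝕊.0#                      ≈⟨ Σ𝕊.1+s≈0 ⟨
  𝕊.1# 𝕊.+ Σ𝕊.s             ≈⟨ 𝕊.+-congˡ {𝕊.1#} (𝕊.*-identityʳ Σ𝕊.s) ⟨
  𝕊.1# 𝕊.+ Σ𝕊.s 𝕊.* 𝕊.1#    ∎
  where open SetoidReasoning 𝕊.setoid
coeffℚ-qint (suc r) = begin
  1-X 𝕊.* coeffℚ (qint (suc r))
    ≈⟨ 𝕊.*-congˡ {1-X} unfold ⟩
  1-X 𝕊.* (𝕊.1# 𝕊.+ X 𝕊.* [r])
    ≈⟨ solve 4 (λ o s x r → (o :+ s :* x) :* (con 1 :+ x :* r) := o :+ (s :* x :+ x :* ((o :+ s :* x) :* r))) 𝕊.refl 𝕊.1# Σ𝕊.s X [r] ⟩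
  𝕊.1# 𝕊.+ (Σ𝕊.s 𝕊.* X 𝕊.+ X 𝕊.* (1-X 𝕊.* [r]))
    ≈⟨ 𝕊.+-congˡ {𝕊.1#} (𝕊.+-congˡ {Σ𝕊.s 𝕊.* X} (𝕊.*-congˡ {X} (coeffℚ-qint r))) ⟩
  𝕊.1# 𝕊.+ (Σ𝕊.s 𝕊.* X 𝕊.+ X 𝕊.* (𝕊.1# 𝕊.+ Σ𝕊.s 𝕊.* pow X r))
    ≈⟨ solve 4 (λ o s x y → o :+ (s :* x :+ x :* (con 1 :+ s :* y)) := o :+ ((s :* x :+ x) :+ s :* (x :* y))) 𝕊.refl 𝕊.1# Σ𝕊.s X (pow X r) ⟩
  𝕊.1# 𝕊.+ ((Σ𝕊.s 𝕊.* X 𝕊.+ X) 𝕊.+ Σ𝕊.s 𝕊.* pow X (suc r))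
    ≈⟨ 𝕊.+-congˡ {𝕊.1#} (𝕊.trans (𝕊.+-congʳ {Σ𝕊.s 𝕊.* pow X (suc r)} (Σ𝕊.sx+x≈0 X)) (𝕊.+-identityˡ (Σ𝕊.s 𝕊.* pow X (suc r)))) ⟩
  𝕊.1# 𝕊.+ Σ𝕊.s 𝕊.* pow X (suc r) ∎
  where
  open SetoidReasoning 𝕊.setoid
  open NaturalCoefficients 𝕊.commutativeSemiring using (solve; _:+_; _:*_; _:=_; con)
  [r] : ℕ → ℚ
  [r] = coeffℚ (qint r)
  unfold : coeffℚ (qint (suc r)) 𝕊.≈ (𝕊.1# 𝕊.+ X 𝕊.* [r])
  unfold = 𝕊.trans (𝕊.sym (coeff-toℚ (qint (suc r)))) (𝕊.trans (coeff-∷ ℚ.1ℚ (toℚ (qint r)))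
    (𝕊.+-congˡ {𝕊.1#} (𝕊.*-congˡ {X} (coeff-toℚ (qint r)))))

coeff-oneMinusQ : ℚP.coeff oneMinusQ 𝕊.≈ 1-X
coeff-oneMinusQ k = ≡.trans (at k) (cong (const ℚ.1ℚ k ℚ.+_) (≡.sym (-1*x≈-x X k)))
  where
  open RingProperties 𝕊.ring using (-1*x≈-x)
  at : ∀ k → ℚP.coeff oneMinusQ k ≡ const ℚ.1ℚ k ℚ.+ ℚ.- X k
  at zero          = ≡.refl
  at (suc zero)    = ≡.refl
  at (suc (suc k)) = ≡.refl

coeff-pow : ∀ p n → ℚP.coeff (ℚP.pow p n) 𝕊.≈ pow (ℚP.coeff p) n
coeff-pow p zero    = coeff-one
coeff-pow p (suc n) = 𝕊.trans (coeff-mul p (ℚP.pow p n)) (𝕊.*-congˡ {ℚP.coeff p} (coeff-pow p n))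

-- The coefficients of H(t) are taken as images of the h_n, not by inverting a series; that they
-- invert E(-t) is inherited from Λ.
a h : ℕ → ℕ → ℚ
a n = const (invFact n) 𝕊.* pow X (n C 2)
h n = lin φ-word (completeE n)

-- The right-hand side is the formula of `P`, so this links φ of the explicit expression to the
-- abstract computation.
lin-powerE : ∀ n r → lin φ-word (powerE n r) 𝕊.≈
  sum (suc n) (λ m → (sgn (m ℕ.+ r) 𝕊.* ι (m C r)) 𝕊.* (a m 𝕊.* h (n ∸ m)))
lin-powerE n r = 𝕊.trans (L𝕊.lin-sumE φ-word (suc n) (λ m → mulE (c m) m (completeE (n ∸ m))))
  (Σ𝕊.sum-cong (suc n) (λ m _ → term m))
  where
  c : ℕ → ℤ
  c m = Sℤ.sgn (m ℕ.+ r) ℤ.* Sℤ.ι (m C r)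
  word : ∀ m μ → φ-word (m ∷ μ) 𝕊.≈ (a m 𝕊.* φ-word μ)
  word m μ = 𝕊.trans (φ-word-∷ m μ) (𝕊.*-congʳ {φ-word μ} (coeff-mono (invFact m) (m C 2)))
  term : ∀ m → lin φ-word (mulE (c m) m (completeE (n ∸ m))) 𝕊.≈
    ((sgn (m ℕ.+ r) 𝕊.* ι (m C r)) 𝕊.* (a m 𝕊.* h (n ∸ m)))
  term m = begin
    lin φ-word (mulE (c m) m (completeE (n ∸ m)))
      ≈⟨ L𝕊.lin-mulE φ-word (c m) m (completeE (n ∸ m)) ⟩
    L𝕊.ρ (c m) 𝕊.* lin (φ-word ∘ (m ∷_)) (completeE (n ∸ m))
      ≈⟨ 𝕊.*-cong (𝕊.trans (L𝕊.ρ-* (Sℤ.sgn (m ℕ.+ r)) (Sℤ.ι (m C r))) (𝕊.*-cong (L𝕊.ρ-sgn (m ℕ.+ r)) (L𝕊.ρ-ι (m C r))))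
           (𝕊.trans (L𝕊.lin-cong (word m) (completeE (n ∸ m))) (L𝕊.lin-* (a m) φ-word (completeE (n ∸ m)))) ⟩
    (sgn (m ℕ.+ r) 𝕊.* ι (m C r)) 𝕊.* (a m 𝕊.* h (n ∸ m)) ∎
    where open SetoidReasoning 𝕊.setoid

specialisation : Specialisation series
specialisation = record
  { q = X
  ; f = λ n → const (invFact n)
  ; f!≈1 = λ n → 𝕊.trans (𝕊.*-congʳ {const (invFact n)} (ι-const (n !))) (𝕊.trans (conv-constˡ (+ (n !) / 1) (const (invFact n))) (inverse n))
  ; h = h
  ; h₀≈1 = 𝕊.trans (𝕊.+-identityʳ _) (𝕊.trans (𝕊.*-identityˡ _) coeff-one)
  -- The relation holds for symmetric functions in any number of variables, and independence
  -- transfers it to the images.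
  ; P₀≈0 = λ n → 𝕊.trans (𝕊.sym (lin-powerE (suc n) 0))
      (Uniqueness.lin-vanishes series scalars φ-word-multiplicative (powerE (suc n) 0) (λ N → coeffE-power-zero n))
  ; [_] = λ r → coeffℚ (qint r)
  ; p*[r] = coeffℚ-qint
  ; J = λ m r → coeffℚ (J′ m m r)
  ; J-zero = λ r → coeffℚ-one
  ; J-suc = J-suc
  }
  where
  inverse : ∀ n k → (+ (n !) / 1) ℚ.* const (invFact n) k ≡ const ℚ.1ℚ k
  inverse n zero    = /1-inverse (n !) {{n ℕₚ.!≢0}}
  inverse n (suc k) = ℚₚ.*-zeroʳ (+ (n !) / 1)
  J-suc : ∀ m r → coeffℚ (J′ (suc m) (suc m) r) 𝕊.≈
    sum (suc m) (λ i → pow (coeffℚ (qint r)) (suc i) 𝕊.* ((ι (suc m C suc i) 𝕊.* pow X (suc i C 2)) 𝕊.* coeffℚ (J′ (m ∸ i) (m ∸ i) (suc i))))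
  J-suc m r = 𝕊.trans (coeffℚ-sum (suc m) term) (Σ𝕊.sum-cong (suc m) (λ i _ → 𝕊.trans
    (coeffℚ-mul (ℕP.pow (qint r) (suc i)) (ℕP.mul (ℕP.mono (suc m C suc i) (suc i C 2)) (J′ m (m ∸ i) (suc i))))
    (𝕊.*-cong (coeffℚ-pow (qint r) (suc i)) (𝕊.trans
      (coeffℚ-mul (ℕP.mono (suc m C suc i) (suc i C 2)) (J′ m (m ∸ i) (suc i)))
      (𝕊.*-cong (coeffℚ-mono (suc m C suc i) (suc i C 2))
        (𝕊.reflexive (cong coeffℚ (J′-depth m (m ∸ i) (m ∸ i) (suc i) (ℕₚ.m∸n≤m m i) ℕₚ.≤-refl))))))))
    where
    term : ℕ → List ℕ
    term j = ℕP.mul (ℕP.pow (qint r) j) (ℕP.mul (ℕP.mono (suc m C j) (j C 2)) (J′ m (suc m ∸ j) j))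

φ-power : ∀ n r → r ≤ n → ∀ E → Represents E n r →
  ℚP._≈_ (ℚP.scale ((+ (r ! ℕ.* (n ∸ r) !)) / 1) (φ E))
         (ℚP.mul (ℚP.pow oneMinusQ (n ∸ r)) (ℚP.mul (ℚP.mono ((+ 1) / 1) (r C 2)) (toℚ (J n r))))
φ-power n r r≤n E E-represents = begin
  ℚP.coeff (ℚP.scale c (φ E))
    ≈⟨ (λ k → ≡.trans (coeff-scale c (φ E) k) (≡.sym (conv-constˡ c (ℚP.coeff (φ E)) k))) ⟩
  const c 𝕊.* ℚP.coeff (φ E)
    ≈⟨ 𝕊.*-cong (𝕊.sym (ι-const (r ! ℕ.* m !))) (𝕊.trans (coeff-φ E)
         -- Here an arbitrary expression for p_n^(r) is exchanged for `powerE n r`.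
         (Uniqueness.lin-unique series scalars φ-word-multiplicative E (powerE n r)
           (λ N α → ≡.trans (E-represents N α) (≡.sym (powerE-represents n r N α))))) ⟩
  ι (r ! ℕ.* m !) 𝕊.* lin φ-word (powerE n r)
    ≈⟨ 𝕊.*-congˡ {ι (r ! ℕ.* m !)} (𝕊.trans (lin-powerE n r) (𝕊.reflexive (cong (λ n → P n r) (≡.sym (ℕₚ.m+[n∸m]≡n r≤n))))) ⟩
  ι (r ! ℕ.* m !) 𝕊.* P (r ℕ.+ m) r
    ≈⟨ Evaluate.factorial-factorial-P specialisation r m ⟩
  pow 1-X m 𝕊.* (pow X (r C 2) 𝕊.* coeffℚ (J′ m m r))
    ≈⟨ 𝕊.*-cong (𝕊.trans (coeff-pow oneMinusQ m) (Σ𝕊.pow-cong m coeff-oneMinusQ))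
         (𝕊.*-cong (𝕊.trans (coeff-mono ℚ.1ℚ (r C 2)) (𝕊.*-identityˡ (pow X (r C 2)))) (coeff-toℚ (J n r))) ⟨
  ℚP.coeff (ℚP.pow oneMinusQ m) 𝕊.* (ℚP.coeff (ℚP.mono ℚ.1ℚ (r C 2)) 𝕊.* ℚP.coeff (toℚ (J n r)))
    ≈⟨ 𝕊.*-congˡ {ℚP.coeff (ℚP.pow oneMinusQ m)} (coeff-mul (ℚP.mono ℚ.1ℚ (r C 2)) (toℚ (J n r))) ⟨
  ℚP.coeff (ℚP.pow oneMinusQ m) 𝕊.* ℚP.coeff (ℚP.mul (ℚP.mono ℚ.1ℚ (r C 2)) (toℚ (J n r)))
    ≈⟨ coeff-mul (ℚP.pow oneMinusQ m) (ℚP.mul (ℚP.mono ℚ.1ℚ (r C 2)) (toℚ (J n r))) ⟨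
  ℚP.coeff (ℚP.mul (ℚP.pow oneMinusQ m) (ℚP.mul (ℚP.mono ℚ.1ℚ (r C 2)) (toℚ (J n r)))) ∎
  where
  open SetoidReasoning 𝕊.setoid
  open Specialisation specialisation using (P)
  m : ℕ
  m = n ∸ r
  c : ℚ
  c = (+ (r ! ℕ.* m !)) / 1

-- With m = n - r and s = r - 1, so that s + m = n - 1, this is `+-C2` after subtraction of C(s,2).
degree≡ : ∀ n s → suc s ≤ n → (n ∸ suc s) ℕ.* s ℕ.+ (n ∸ suc s) C 2 ≡ ((n ∸ 1) C 2) ∸ (s C 2)
degree≡ (suc n) s (s≤s s≤n) = begin
  m ℕ.* s ℕ.+ m C 2                          ≡⟨ ℕₚ.+-comm (m ℕ.* s) (m C 2) ⟩
  m C 2 ℕ.+ m ℕ.* s                          ≡⟨ cong (m C 2 ℕ.+_) (ℕₚ.*-comm m s) ⟩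
  m C 2 ℕ.+ s ℕ.* m                          ≡⟨ ℕₚ.m+n∸m≡n (s C 2) _ ⟨
  s C 2 ℕ.+ (m C 2 ℕ.+ s ℕ.* m) ∸ s C 2      ≡⟨ cong (_∸ s C 2) (+-C2 s m) ⟨
  (s ℕ.+ m) C 2 ∸ s C 2                      ≡⟨ cong (λ k → k C 2 ∸ s C 2) (ℕₚ.m+[n∸m]≡n s≤n) ⟩
  n C 2 ∸ s C 2                              ∎
  where
  open ≡.≡-Reasoning
  m : ℕ
  m = n ∸ s

open import Data.Nat using (_*_)

theorem6p3 : Σ (ℕ → ℕ → List ℕ) λ J →
    (∀ n r → 1 ≤ r → r ≤ n →
    Σ EExpr (λ E → Represents E n r)
    × (∀ E → Represents E n r →
    ℚP._≈_ (ℚP.scale ((+ (r ! * (n ∸ r) !)) / 1) (φ E))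
    (ℚP.mul (ℚP.pow oneMinusQ (n ∸ r))
    (ℚP.mul (ℚP.mono ((+ 1) / 1) (r C 2)) (toℚ (J n r))))))
    × (∀ n r → 1 ≤ r → r ≤ n →
    ℕP.MonicOfDegree (J n r) (((n ∸ 1) C 2) ∸ ((r ∸ 1) C 2))
    × ℕP.coeff (J n r) 0 ≡ (n ∸ r) !)
    × (∀ r → 1 ≤ r → ℕP._≈_ (J r r) ℕP.one)
    × (∀ n r → 1 ≤ r → r ≤ n ∸ 1 →
    ℕP._≈_ (J n r)
    (sumℕP (n ∸ r) (λ j →
    ℕP.mul (ℕP.pow (qint r) j)
    (ℕP.mul (ℕP.mono ((n ∸ r) C j) (j C 2)) (J (n ∸ r) j)))))
theorem6p3 = J
  , (λ n r 1≤r r≤n → (powerE n r , powerE-represents n r) , φ-power n r r≤n)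
  , (λ { n (suc s) _ r≤n →
         ≡.subst (ℕP.MonicOfDegree (J n (suc s))) (degree≡ n s r≤n) (J′-monic (n ∸ suc s) (n ∸ suc s) s ℕₚ.≤-refl)
       , J′-constant (n ∸ suc s) (n ∸ suc s) s ℕₚ.≤-refl })
  , (λ r _ k → cong (λ m → ℕP.coeff (J′ m m r) k) (ℕₚ.n∸n≡0 r))
  , (λ n r 1≤r r≤n-1 k → cong (λ p → ℕP.coeff p k) (J-recurrence n r 1≤r r≤n-1))
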